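{- Let $B$ be a finite connected left regular band and $\Bbbk$ a field. For each $X\in\Lambda(B)$ fix $e_X\in B$ with $Be_X=X$, and let $L_Y=\{b\in B\mid Bb=Y\}$. Then for $X,Y\in\Lambda(B)$ the Cartan invariant of $\Bbbk B$ is $$C_{X,Y}=\sum_{Z\le X}|e_ZB\cap L_Y|\cdot\mu(Z,X),$$ where $\mu$ is the Möbius function of $\Lambda(B)$. Moreover $C_{X,Y}=0$ unless $X\ge Y$, and $C_{X,X}=1$ (so the Cartan matrix is unipotent lower triangular with respect to any linear extension of the order on $\Lambda(B)$).
   Context: A left regular band is a finite semigroup $B$ with $x^2=x$, $xyx=xy$; $\Lambda(B)=\{Bb\mid b\in B\}$ ordered by inclusion is its support semilattice, and $B_{\ge X}=\{b\mid Bb\supseteq X\}$. $B$ is connected if the order complex (simplicial complex of chains) of each poset $B_{\ge X}$ is connected, where $B$ is ordered by $a\le b$ iff $ba=a$; in this case $\Bbbk B$ is unital. For $X\in\Lambda(B)$, $\Bbbk_X$ denotes $\Bbbk$ with $b\in B$ acting as $1$ if $Bb\supseteq X$ and as $0$ otherwise; these are the simple $\Bbbk B$-modules. The Schützenberger module $\Bbbk L_X$ is the free $\Bbbk$-module on $L_X$ with $a\cdot b=ab$ if $Ba\supseteq X$ and $a\cdot b=0$ otherwise; these are the projective indecomposable $\Bbbk B$-modules ($\Bbbk L_X$ is the projective cover of $\Bbbk_X$). The Cartan invariant $C_{X,Y}$ is the multiplicity of $\Bbbk_X$ as a composition factor of $\Bbbk L_Y$. -}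

module Defs where

open import Level using (Level; _⊔_) renaming (suc to lsuc)
open import Data.Nat using (ℕ; zero; suc)
open import Data.Fin using (Fin; zero; suc; fromℕ; inject₁; _≟_)
open import Data.Fin.Subset using (Subset; _⊆_)
open import Data.Fin.Subset.Properties using (_⊆?_)
open import Data.Fin.Properties using (any?)
open import Data.Vec using (tabulate)
open import Data.Vec.Properties using (≡-dec)
import Data.Bool as Bool
open import Data.Bool using (if_then_else_; _∧_)
open import Data.List using (List; []; _∷_; map; filter; length; deduplicate; foldr)
open import Data.List using (allFin)
open import Data.Integer as ℤ using (ℤ; +_)
open import Data.Product using (Σ; ∃; _×_; _,_)
open import Data.Sum using (_⊎_)
open import Relation.Nullary using (¬_; Dec; does; _×-dec_)
open import Relation.Binary.PropositionalEquality using (_≡_; _≢_)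
open import Relation.Binary.Definitions using (DecidableEquality)
open import Algebra.Bundles using (CommutativeRing)

record Field c ℓ : Set (lsuc (c ⊔ ℓ)) where
  field
    commutativeRing : CommutativeRing c ℓ
  open CommutativeRing commutativeRing public
  field
    1≉0     : ¬ (1# ≈ 0#)
    inverse : ∀ x → ¬ (x ≈ 0#) → ∃ λ y → x * y ≈ 1#

record LRB (n : ℕ) : Set where
  infixl 7 _∙_
  field
    _∙_         : Fin n → Fin n → Fin n
    assoc       : ∀ x y z → (x ∙ y) ∙ z ≡ x ∙ (y ∙ z)
    idem        : ∀ x → x ∙ x ≡ x
    leftRegular : ∀ x y → x ∙ y ∙ x ≡ x ∙ y

_≟S_ : ∀ {n} → DecidableEquality (Subset n)
_≟S_ = ≡-dec Bool._≟_

sumℤ : List ℤ → ℤ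
sumℤ = foldr ℤ._+_ (+ 0)

count : ∀ {n p} {P : Fin n → Set p} → (∀ i → Dec (P i)) → ℕ
count P? = length (filter P? (allFin _))

module LRBNotions {n : ℕ} (B : LRB n) where
  open LRB B

  principal : Fin n → Subset n
  principal b = tabulate (λ c → does (any? (λ a → a ∙ b ≟ c)))

  InΛ : Subset n → Set
  InΛ X = ∃ λ b → principal b ≡ X

  ΛList : List (Subset n)
  ΛList = deduplicate _≟S_ (map principal (allFin n))

  _≤B_ : Fin n → Fin n → Set
  a ≤B b = b ∙ a ≡ a

  Comparable : Fin n → Fin n → Set
  Comparable a b = a ≤B b ⊎ b ≤B a

  -- paths in the comparability graph (= 1-skeleton of the order
  -- complex) of B_{≥X} = {b | Bb ⊇ X}
  data Zigzag (X : Subset n) : Fin n → Fin n → Set where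
    here : ∀ {a} → Zigzag X a a
    step : ∀ {a b c} → X ⊆ principal b → Comparable a b →
           Zigzag X b c → Zigzag X a c

  -- connected: the order complex of each B_{≥X} (X ∈ Λ(B)) is connected
  Connected : Set
  Connected = ∀ X → InΛ X → ∀ a b → X ⊆ principal a → X ⊆ principal b →
              Zigzag X a b

  record IsMobius (μ : Subset n → Subset n → ℤ) : Set where
    field
      mobius-sum : ∀ Z X → InΛ Z → InΛ X → Z ⊆ X →
        sumℤ (map (μ Z) (filter (λ W → (Z ⊆? W) ×-dec (W ⊆? X)) ΛList))
          ≡ (if does (Z ≟S X) then + 1 else + 0)
      mobius-zero : ∀ Z X → InΛ Z → InΛ X → ¬ (Z ⊆ X) → μ Z X ≡ + 0

  card-eB∩L : Fin n → Subset n → ℕ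
  card-eB∩L e Y =
    count (λ c → any? (λ a → e ∙ a ≟ c) ×-dec (principal c ≟S Y))

  cartanFormula : (Subset n → Fin n) → (Subset n → Subset n → ℤ) →
                  Subset n → Subset n → ℤ
  cartanFormula e μ X Y =
    sumℤ (map (λ Z → (+ card-eB∩L (e Z) Y) ℤ.* μ Z X)
              (filter (λ Z → Z ⊆? X) ΛList))

  module Modules {c ℓ : Level} (K : Field c ℓ) where
    open Field K using (Carrier; _≈_; _+_; _*_; _-_; 0#; 1#)

    sumK : ∀ {m} → (Fin m → Carrier) → Carrier
    sumK {zero}  f = 0#
    sumK {suc m} f = f zero + sumK (λ i → f (suc i))

    -- ambient coordinate space 𝕜^B; 𝕜L_Y is the subspace of vectors
    -- supported on L_Y
    V : Set c
    V = Fin n → Carrier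

    _≈V_ : V → V → Set ℓ
    u ≈V v = ∀ i → u i ≈ v i

    0V : V
    0V _ = 0#

    _+V_ : V → V → V
    (u +V v) i = u i + v i

    _·V_ : Carrier → V → V
    (a ·V v) i = a * v i

    _-V_ : V → V → V
    (u -V v) i = u i - v i

    InKL : Subset n → V → Set ℓ
    InKL Y v = ∀ x → principal x ≢ Y → v x ≈ 0#

    -- action of b on 𝕜L_Y:  b · a = b a  if Bb ⊇ Y, and 0 otherwise
    act : Subset n → Fin n → V → V
    act Y b v x =
      if does (Y ⊆? principal b)
      then sumK (λ a → if does ((b ∙ a ≟ x) ×-dec (principal a ≟S Y))
                       then v a else 0#)
      else 0#

    -- action of b on the simple module 𝕜_X
    χ : Subset n → Fin n → Carrier
    χ X b = if does (X ⊆? principal b) then 1# else 0#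

    record Submodule (Y : Subset n) : Set (lsuc (c ⊔ ℓ)) where
      field
        _∋_    : V → Set (c ⊔ ℓ)
        resp   : ∀ {u v} → u ≈V v → _∋_ u → _∋_ v
        ∋0     : _∋_ 0V
        ∋+     : ∀ {u v} → _∋_ u → _∋_ v → _∋_ (u +V v)
        ∋·     : ∀ a {v} → _∋_ v → _∋_ (a ·V v)
        ∋act   : ∀ b {v} → _∋_ v → _∋_ (act Y b v)
        ⊆KL    : ∀ {v} → _∋_ v → InKL Y v
    open Submodule public

    -- U ⊆ W and W/U ≅ 𝕜_X as 𝕜B-modules: an isomorphism 𝕜_X → W/U is
    -- given by 1 ↦ [v] with [v] ≠ 0, [v] spanning W/U and b[v] = χ_X(b)[v].
    FactorIso : ∀ {Y} → Submodule Y → Submodule Y → Subset n → Set (c ⊔ ℓ)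
    FactorIso {Y} U W X =
      Σ V λ v → (W ∋ v) × ¬ (U ∋ v)
        × (∀ w → W ∋ w → ∃ λ a → U ∋ (w -V (a ·V v)))
        × (∀ b → U ∋ (act Y b v -V (χ X b ·V v)))

    -- a composition series 0 = W₀ ⊂ W₁ ⊂ ⋯ ⊂ W_m = 𝕜L_Y, each factor
    -- W_{i+1}/W_i being labelled by the simple module 𝕜_{X_i} it is
    -- isomorphic to (every simple 𝕜B-module is some 𝕜_X)
    record CompositionSeries (Y : Subset n) : Set (lsuc (c ⊔ ℓ)) where
      field
        len     : ℕ
        W       : Fin (suc len) → Submodule Y
        label   : Fin len → Subset n
        bottom  : ∀ v → W zero ∋ v → v ≈V 0V
        top     : ∀ v → InKL Y v → W (fromℕ len) ∋ v
        mono    : ∀ i v → W (inject₁ i) ∋ v → W (suc i) ∋ v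
        labelΛ  : ∀ i → InΛ (label i)
        factor  : ∀ i → FactorIso (W (inject₁ i)) (W (suc i)) (label i)

    multiplicity : ∀ {Y} → CompositionSeries Y → Subset n → ℕ
    multiplicity s X =
      count (λ i → CompositionSeries.label s i ≟S X)

    CartanInvariantIs : Subset n → Subset n → ℕ → Set (lsuc (c ⊔ ℓ))
    CartanInvariantIs X Y k =
      CompositionSeries Y × (∀ (s : CompositionSeries Y) → multiplicity s X ≡ k)

{-# OPTIONS --safe #-}

-- Let m_Z be the multiplicity of 𝕜_Z in a composition series of 𝕜L_Y. The idempotent e_X acts by 1
-- on 𝕜_Z if Z ≤ X and by 0 otherwise, so its rank on 𝕜L_Y is Σ_{Z ≤ X} m_Z. On the other hand its
-- image there has basis e_X B ∩ L_Y, and Möbius inversion gives the formula. Equality in 𝕜 is not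
-- decidable, but dimension counts are equations in ℕ, so classical linear algebra applies to them.
--
-- A composition series has to be exhibited outright, so a full flag of submodules is constructed
-- over ℤ. Take a basis vector of the dual of the current submodule of ℤL_Y and let b act on it,
-- with b of minimal support such that the result f is nonzero. Then f is an eigenvector for the
-- dual action, of character χ_{Bb}: for any a either ba = b, or ba has smaller support and fa = 0.
-- Dividing f by its content and completing it to a basis splits off one factor. Such a b exists
-- because the action is unital, and this is where connectedness enters.
module Submission where

open import Defs
open import Level using (Level; Lift; lift; lower; _⊔_)
open import Algebra.Bundles using (CommutativeRing)
import Algebra.Properties.AbelianGroup
import Algebra.Properties.Ring
import Algebra.Properties.Semiring.Mult
import Algebra.Properties.Semiring.Sum
import Algebra.Solver.Ring
open import Algebra.Solver.Ring.AlmostCommutativeRing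
  using (fromCommutativeRing; _-Raw-AlmostCommutative⟶_; AlmostCommutativeRing)
open import Data.Bool using (true; false; if_then_else_)
open import Data.Fin using (Fin; zero; suc; _≟_; inject₁; fromℕ; punchIn)
open import Data.Fin.Induction using (po-wellFounded; spo-wellFounded; spo-noetherian)
open import Data.Fin.Permutation.Components using (transpose; transpose-inverse)
open import Data.Fin.Properties using (any?; suc-injective)
open import Data.Fin.Subset using (Subset; _⊆_) renaming (_∈_ to _∈ₛ_)
open import Data.Fin.Subset.Properties using (_⊆?_; ⊆-antisym; ⊆-reflexive)
open import Data.Integer as ℤ using (ℤ; +_; -[1+_])
import Data.Integer.DivMod as ℤ
import Data.Integer.Properties as ℤ
open import Data.Integer.Tactic.RingSolver using (solve-∀)
open import Data.List using (List; []; _∷_; allFin; filter; length; lookup; map; tabulate)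
open import Data.List.Membership.Propositional using (_∈_; _∉_)
open import Data.List.Membership.Propositional.Properties
  using (∈-allFin; ∈-deduplicate⁺; ∈-deduplicate⁻; ∈-filter⁺; ∈-filter⁻; ∈-lookup; ∈-map⁺; ∈-map⁻)
import Data.List.Relation.Unary.All as All
open import Data.List.Relation.Unary.AllPairs using ([]; _∷_)
open import Data.List.Relation.Unary.Any using (here; there; index)
open import Data.List.Relation.Unary.Any.Properties using (lookup-index)
open import Data.List.Relation.Unary.Unique.DecPropositional.Properties using (deduplicate-!)
open import Data.List.Relation.Unary.Unique.Propositional using (Unique)
open import Data.List.Relation.Unary.Unique.Propositional.Properties using (filter⁺; allFin⁺)
import Data.Maybe as Maybe
open import Data.Nat as ℕ using (ℕ; zero; suc; z≤n; s≤s)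
import Data.Nat.Induction as ℕ
import Data.Nat.Properties as ℕ
open import Data.Product using (∃; Σ; _×_; _,_; proj₁; proj₂)
open import Data.Sum using (inj₁; inj₂)
open import Data.Vec.Functional using (insertAt)
open import Data.Vec.Functional.Properties using (insertAt-lookup; insertAt-punchIn)
open import Data.Vec.Properties using (lookup∘tabulate; []=⇒lookup; lookup⇒[]=)
open import Function using (id; flip; _∘_)
open import Induction.WellFounded using (WellFounded; Acc; acc)
open import Relation.Binary.PropositionalEquality as ≡ using (_≡_; _≢_)
open import Relation.Binary.Structures using (IsPartialOrder; IsStrictPartialOrder)
open import Relation.Nullary using (¬_; Dec; yes; no; does; contradiction; ¬?; _×-dec_)
open import Relation.Nullary.Decidable using (dec-true; dec-false; dec⇒maybe; decidable-stable)
open import Relation.Unary using (Decidable)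

-- Choosing an element that acts nontrivially and clearing coefficients both require deciding
-- whether a number is zero; this is why the flag lives over ℤ. It has to survive the passage to a
-- field of any characteristic, so every stage is kept a direct summand with a dual basis, and the
-- eigenvector has to be divided by its content. A stage is handled through the integral functionals
-- that annihilate it: over ℤ they express closure under B, and over 𝕜 they are the equations of the
-- submodule.
--
-- Unitality enters as the vanishing of the product of all 1 - b, b in B, acting from the left.
-- Expanded, it makes 1 an integral combination of elements of B, so that a nonzero functional has a
-- nonzero translate.
--
-- The rank of b is measured on its fixed vectors, which form its image because b is idempotent.
-- Being fixed is an equation, so it restricts to each member of a composition series.

-- Finite sums and the standard pairing over a commutative ring.

module FiniteSums {c ℓ} (R : CommutativeRing c ℓ) where
  open CommutativeRing R hiding (zero)
  open Algebra.Properties.Semiring.Sum semiring public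
  open import Relation.Binary.Reasoning.Setoid setoid

  sum-zero : ∀ {m} {f : Fin m → Carrier} → (∀ i → f i ≈ 0#) → sum f ≈ 0#
  sum-zero {m} z = trans (sum-cong-≋ z) (sum-replicate-zero m)

  sum-single : ∀ {m} {f : Fin m → Carrier} k → (∀ i → i ≢ k → f i ≈ 0#) → sum f ≈ f k
  sum-single {f = f} zero z =
    trans (+-congˡ (sum-zero (λ i → z (suc i) (λ ())))) (+-identityʳ (f zero))
  sum-single {f = f} (suc k) z =
    trans (+-cong (z zero (λ ())) (sum-single k (λ i i≢k → z (suc i) (i≢k ∘ suc-injective))))
          (+-identityˡ (f (suc k)))

  ⟪_,_⟫ : ∀ {m} → (Fin m → Carrier) → (Fin m → Carrier) → Carrier
  ⟪ f , v ⟫ = sum (λ x → f x * v x)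

  ⟪⟫-cong : ∀ {m} {f f′ v v′ : Fin m → Carrier} →
            (∀ x → f x ≈ f′ x) → (∀ x → v x ≈ v′ x) → ⟪ f , v ⟫ ≈ ⟪ f′ , v′ ⟫
  ⟪⟫-cong p q = sum-cong-≋ (λ x → *-cong (p x) (q x))

  ⟪⟫-comm : ∀ {m} (f v : Fin m → Carrier) → ⟪ f , v ⟫ ≈ ⟪ v , f ⟫
  ⟪⟫-comm f v = sum-cong-≋ (λ x → *-comm (f x) (v x))

  ⟪⟫-+ˡ : ∀ {m} (f g v : Fin m → Carrier) →
          ⟪ (λ x → f x + g x) , v ⟫ ≈ ⟪ f , v ⟫ + ⟪ g , v ⟫
  ⟪⟫-+ˡ f g v = trans (sum-cong-≋ (λ x → distribʳ (v x) (f x) (g x)))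
                      (∑-distrib-+ (λ x → f x * v x) (λ x → g x * v x))

  ⟪⟫-*ˡ : ∀ {m} a (f v : Fin m → Carrier) → ⟪ (λ x → a * f x) , v ⟫ ≈ a * ⟪ f , v ⟫
  ⟪⟫-*ˡ a f v = trans (sum-cong-≋ (λ x → *-assoc a (f x) (v x)))
                      (sym (*-distribˡ-sum a (λ x → f x * v x)))

  ⟪⟫-+ʳ : ∀ {m} (f u v : Fin m → Carrier) →
          ⟪ f , (λ x → u x + v x) ⟫ ≈ ⟪ f , u ⟫ + ⟪ f , v ⟫
  ⟪⟫-+ʳ f u v = trans (sum-cong-≋ (λ x → distribˡ (f x) (u x) (v x)))
                      (∑-distrib-+ (λ x → f x * u x) (λ x → f x * v x))

  ⟪⟫-*ʳ : ∀ {m} a (f v : Fin m → Carrier) → ⟪ f , (λ x → a * v x) ⟫ ≈ a * ⟪ f , v ⟫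
  ⟪⟫-*ʳ a f v = trans (⟪⟫-comm f (λ x → a * v x))
                      (trans (⟪⟫-*ˡ a v f) (*-congˡ (⟪⟫-comm v f)))

  private module P = Algebra.Properties.Ring ring

  ⟪⟫-negˡ : ∀ {m} (f v : Fin m → Carrier) → ⟪ (λ x → - f x) , v ⟫ ≈ - ⟪ f , v ⟫
  ⟪⟫-negˡ f v = begin
    ⟪ (λ x → - f x) , v ⟫       ≈⟨ ⟪⟫-cong (λ x → P.-1*x≈-x (f x)) (λ _ → refl) ⟨
    ⟪ (λ x → - 1# * f x) , v ⟫  ≈⟨ ⟪⟫-*ˡ (- 1#) f v ⟩
    - 1# * ⟪ f , v ⟫            ≈⟨ P.-1*x≈-x _ ⟩
    - ⟪ f , v ⟫                 ∎

  ⟪⟫-∸ˡ : ∀ {m} (f : Fin m → Carrier) a (g v : Fin m → Carrier) →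
          ⟪ (λ x → f x - a * g x) , v ⟫ ≈ ⟪ f , v ⟫ - a * ⟪ g , v ⟫
  ⟪⟫-∸ˡ f a g v = trans (⟪⟫-+ˡ f (λ x → - (a * g x)) v)
    (+-congˡ (trans (⟪⟫-negˡ (λ x → a * g x) v) (-‿cong (⟪⟫-*ˡ a g v))))

  ⟪⟫-∸ʳ : ∀ {m} (f u : Fin m → Carrier) a (v : Fin m → Carrier) →
          ⟪ f , (λ x → u x - a * v x) ⟫ ≈ ⟪ f , u ⟫ - a * ⟪ f , v ⟫
  ⟪⟫-∸ʳ f u a v = begin
    ⟪ f , (λ x → u x - a * v x) ⟫  ≈⟨ ⟪⟫-comm f (λ x → u x - a * v x) ⟩
    ⟪ (λ x → u x - a * v x) , f ⟫  ≈⟨ ⟪⟫-∸ˡ u a v f ⟩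
    ⟪ u , f ⟫ - a * ⟪ v , f ⟫      ≈⟨ +-cong (⟪⟫-comm u f) (-‿cong (*-congˡ (⟪⟫-comm v f))) ⟩
    ⟪ f , u ⟫ - a * ⟪ f , v ⟫      ∎

  ⟪⟫-sumˡ : ∀ {m r} (a : Fin r → Carrier) (g : Fin r → Fin m → Carrier) (v : Fin m → Carrier) →
            ⟪ (λ x → sum (λ j → a j * g j x)) , v ⟫ ≈ sum (λ j → a j * ⟪ g j , v ⟫)
  ⟪⟫-sumˡ a g v = begin
    sum (λ x → sum (λ j → a j * g j x) * v x)
      ≈⟨ sum-cong-≋ (λ x → *-distribʳ-sum (v x) (λ j → a j * g j x)) ⟩
    sum (λ x → sum (λ j → a j * g j x * v x))
      ≈⟨ ∑-comm (λ x j → a j * g j x * v x) ⟩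
    sum (λ j → sum (λ x → a j * g j x * v x))
      ≈⟨ sum-cong-≋ (λ j → ⟪⟫-*ˡ (a j) (g j) v) ⟩
    sum (λ j → a j * ⟪ g j , v ⟫) ∎

module ℤΣ = FiniteSums ℤ.+-*-commutativeRing

-- The canonical homomorphism from ℤ to a commutative ring.

module FromIntegers {c ℓ} (R : CommutativeRing c ℓ) where
  open CommutativeRing R hiding (zero)
  open Algebra.Properties.Semiring.Mult semiring using (×-homo-+; ×1-homo-*; ×-homo-1)
    renaming (_×_ to _×ₙ_)
  open Algebra.Properties.Ring ring using (-‿distribˡ-*; -‿distribʳ-*; -‿involutive; -0#≈0#)
  open Algebra.Properties.AbelianGroup +-abelianGroup using () renaming (⁻¹-∙-comm to -‿+-comm)
  open import Relation.Binary.Reasoning.Setoid setoid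
  open FiniteSums R

  ι : ℤ → Carrier
  ι (+ n)    = n ×ₙ 1#
  ι -[1+ n ] = - (suc n ×ₙ 1#)

  ι-neg : ∀ i → ι (ℤ.- i) ≈ - ι i
  ι-neg (+ zero)  = sym -0#≈0#
  ι-neg (+ suc n) = refl
  ι-neg -[1+ n ]  = sym (-‿involutive _)

  ι-⊖ : ∀ m n → ι (m ℤ.⊖ n) ≈ m ×ₙ 1# - n ×ₙ 1#
  ι-⊖ m       zero    = sym (trans (+-congˡ -0#≈0#) (+-identityʳ _))
  ι-⊖ zero    (suc n) = sym (+-identityˡ _)
  ι-⊖ (suc m) (suc n) = begin
    ι (suc m ℤ.⊖ suc n)                 ≡⟨ ≡.cong ι (ℤ.[1+m]⊖[1+n]≡m⊖n m n) ⟩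
    ι (m ℤ.⊖ n)                         ≈⟨ ι-⊖ m n ⟩
    m ×ₙ 1# - n ×ₙ 1#                     ≈⟨ +-congʳ (+-identityˡ _) ⟨
    0# + m ×ₙ 1# - n ×ₙ 1#                ≈⟨ +-congʳ (+-congʳ (-‿inverseʳ 1#)) ⟨
    1# - 1# + m ×ₙ 1# - n ×ₙ 1#           ≈⟨ +-congʳ (trans (+-assoc _ _ _)
                                             (trans (+-congˡ (+-comm _ _)) (sym (+-assoc _ _ _)))) ⟩
    1# + m ×ₙ 1# - 1# - n ×ₙ 1#           ≈⟨ +-assoc _ _ _ ⟩
    1# + m ×ₙ 1# + (- 1# - n ×ₙ 1#)       ≈⟨ +-congˡ (-‿+-comm _ _) ⟩
    suc m ×ₙ 1# - suc n ×ₙ 1#             ∎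

  ι-+ : ∀ i j → ι (i ℤ.+ j) ≈ ι i + ι j
  ι-+ (+ m)    (+ n)    = ×-homo-+ 1# m n
  ι-+ (+ m)    -[1+ n ] = ι-⊖ m (suc n)
  ι-+ -[1+ m ] (+ n)    = trans (ι-⊖ n (suc m)) (+-comm _ _)
  ι-+ -[1+ m ] -[1+ n ] = begin
    - (suc (suc (m ℕ.+ n)) ×ₙ 1#)        ≡⟨ ≡.cong (λ k → - (suc k ×ₙ 1#)) (ℕ.+-suc m n) ⟨
    - ((suc m ℕ.+ suc n) ×ₙ 1#)          ≈⟨ -‿cong (×-homo-+ 1# (suc m) (suc n)) ⟩
    - (suc m ×ₙ 1# + suc n ×ₙ 1#)         ≈⟨ -‿+-comm _ _ ⟨
    - (suc m ×ₙ 1#) - suc n ×ₙ 1#         ∎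

  private
    ι-*⁺ : ∀ m j → ι (+ m ℤ.* j) ≈ ι (+ m) * ι j
    ι-*⁺ m (+ n) = trans (reflexive (≡.cong ι (≡.sym (ℤ.pos-* m n)))) (×1-homo-* m n)
    ι-*⁺ m -[1+ n ] = begin
      ι (+ m ℤ.* ℤ.- (+ suc n))        ≡⟨ ≡.cong ι (ℤ.neg-distribʳ-* (+ m) (+ suc n)) ⟨
      ι (ℤ.- (+ m ℤ.* + suc n))        ≈⟨ ι-neg (+ m ℤ.* + suc n) ⟩
      - ι (+ m ℤ.* + suc n)            ≈⟨ -‿cong (ι-*⁺ m (+ suc n)) ⟩
      - (ι (+ m) * ι (+ suc n))        ≈⟨ -‿distribʳ-* _ _ ⟩
      ι (+ m) * ι -[1+ n ]             ∎

  ι-* : ∀ i j → ι (i ℤ.* j) ≈ ι i * ι j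
  ι-* (+ m)    j = ι-*⁺ m j
  ι-* -[1+ m ] j = begin
    ι (ℤ.- (+ suc m) ℤ.* j)          ≡⟨ ≡.cong ι (ℤ.neg-distribˡ-* (+ suc m) j) ⟨
    ι (ℤ.- (+ suc m ℤ.* j))          ≈⟨ ι-neg (+ suc m ℤ.* j) ⟩
    - ι (+ suc m ℤ.* j)              ≈⟨ -‿cong (ι-*⁺ (suc m) j) ⟩
    - (ι (+ suc m) * ι j)            ≈⟨ -‿distribˡ-* _ _ ⟩
    ι -[1+ m ] * ι j                 ∎

  ι-1 : ι (+ 1) ≈ 1#
  ι-1 = ×-homo-1 1#

  ι-sum : ∀ {m} (f : Fin m → ℤ) → ι (ℤΣ.sum f) ≈ sum (λ i → ι (f i))
  ι-sum {zero}  f = refl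
  ι-sum {suc m} f = trans (ι-+ (f zero) _) (+-congˡ (ι-sum (λ i → f (suc i))))

  ι-⟪⟫ : ∀ {m} (f v : Fin m → ℤ) → ι (ℤΣ.⟪ f , v ⟫) ≈ ⟪ (λ x → ι (f x)) , (λ x → ι (v x)) ⟫
  ι-⟪⟫ f v = trans (ι-sum (λ x → f x ℤ.* v x)) (sum-cong-≋ (λ x → ι-* (f x) (v x)))

  private
    target : AlmostCommutativeRing _ _
    target = fromCommutativeRing R

    ℤ⟶R : AlmostCommutativeRing.rawRing (fromCommutativeRing ℤ.+-*-commutativeRing) -Raw-AlmostCommutative⟶ target
    ℤ⟶R = record
      { ⟦_⟧ = ι ; +-homo = ι-+ ; *-homo = ι-* ; -‿homo = ι-neg ; 0-homo = refl ; 1-homo = ι-1 }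

  -- Coefficients are taken in ℤ, where equality is decidable, so the solver can normalise
  -- polynomials over 𝕜.
  open Algebra.Solver.Ring _ target ℤ⟶R
    (λ i j → Maybe.map (λ p → reflexive (≡.cong ι p)) (dec⇒maybe (i ℤ.≟ j))) public
    using (solve; _:=_; _:+_; _:*_; :-_; _:-_; con)

-- Supports, and unitality from connectedness.

module Support {n : ℕ} (B : LRB n) where
  open ≡ using (refl; sym; trans; cong; cong₂; subst; isEquivalence; module ≡-Reasoning)
  open ℤΣ using (sum; sum-single)
  open LRB B
  open LRBNotions B

  -- a ⊑ b encodes the inclusion Ba ⊆ Bb of supports.
  infix 4 _⊑_ _⊏_ _⊑?_ _⊏?_
  _⊑_ _⊏_ : Fin n → Fin n → Set
  a ⊑ b = a ∙ b ≡ a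
  a ⊏ b = a ⊑ b × ¬ b ⊑ a

  _⊑?_ : ∀ a b → Dec (a ⊑ b)
  a ⊑? b = a ∙ b ≟ a

  _⊏?_ : ∀ a b → Dec (a ⊏ b)
  a ⊏? b = (a ⊑? b) ×-dec ¬? (b ⊑? a)

  ⊑-refl : ∀ {a} → a ⊑ a
  ⊑-refl = idem _

  ⊑-trans : ∀ {a b c} → a ⊑ b → b ⊑ c → a ⊑ c
  ⊑-trans {a} {b} {c} ab bc = begin
    a ∙ c        ≡⟨ cong (_∙ c) ab ⟨
    a ∙ b ∙ c    ≡⟨ assoc a b c ⟩
    a ∙ (b ∙ c)  ≡⟨ cong (a ∙_) bc ⟩
    a ∙ b        ≡⟨ ab ⟩
    a            ∎
    where open ≡-Reasoning

  ∙-⊑ˡ : ∀ a b → a ∙ b ⊑ a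
  ∙-⊑ˡ = leftRegular

  ∙-⊑ʳ : ∀ a b → a ∙ b ⊑ b
  ∙-⊑ʳ a b = trans (assoc a b b) (cong (a ∙_) (idem b))

  -- With `∙-⊑ˡ` and `∙-⊑ʳ` this makes B(ab) the intersection of Ba and Bb; hence, for x in L_Y, bx
  -- stays in L_Y exactly when Bb contains Y.
  ∙-greatest : ∀ {a b c} → c ⊑ a → c ⊑ b → c ⊑ a ∙ b
  ∙-greatest {a} {b} {c} ca cb = trans (sym (assoc c a b)) (trans (cong (_∙ b) ca) cb)

  ⊏-isStrictPartialOrder : IsStrictPartialOrder _≡_ _⊏_
  ⊏-isStrictPartialOrder = record
    { isEquivalence = isEquivalence
    ; irrefl        = λ { refl (p , ¬p) → ¬p p }
    ; trans         = λ { (p , ¬p) (q , _) → ⊑-trans p q , λ r → ¬p (⊑-trans q r) }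
    ; <-resp-≈      = (λ { refl p → p }) , (λ { refl p → p })
    }

  ⊏-wellFounded : WellFounded _⊏_
  ⊏-wellFounded = spo-wellFounded ⊏-isStrictPartialOrder

  ⊏-noetherian : WellFounded (flip _⊏_)
  ⊏-noetherian = spo-noetherian ⊏-isStrictPartialOrder

  ∈-principal⁺ : ∀ {c b} → c ⊑ b → c ∈ₛ principal b
  ∈-principal⁺ {c} {b} cb = lookup⇒[]= c (principal b)
    (trans (lookup∘tabulate _ c) (dec-true (any? (λ a → a ∙ b ≟ c)) (c , cb)))

  ∈-principal⁻ : ∀ {c b} → c ∈ₛ principal b → c ⊑ b
  ∈-principal⁻ {c} {b} c∈ with any? (λ a → a ∙ b ≟ c) in eq
  ... | yes (a , refl) = ∙-⊑ʳ a b
  ... | no ¬p with trans (sym ([]=⇒lookup c∈))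
                         (trans (lookup∘tabulate _ c) (dec-false (any? (λ a → a ∙ b ≟ c)) ¬p))
  ...   | ()

  ⊆-principal⁺ : ∀ {a b} → a ⊑ b → principal a ⊆ principal b
  ⊆-principal⁺ ab x∈ = ∈-principal⁺ (⊑-trans (∈-principal⁻ x∈) ab)

  ⊆-principal⁻ : ∀ {a b} → principal a ⊆ principal b → a ⊑ b
  ⊆-principal⁻ p = ∈-principal⁻ (p (∈-principal⁺ ⊑-refl))

  ≡-principal⁺ : ∀ {a b} → a ⊑ b → b ⊑ a → principal a ≡ principal b
  ≡-principal⁺ ab ba = ⊆-antisym (⊆-principal⁺ ab) (⊆-principal⁺ ba)

  ≡-principal⁻ : ∀ {a b} → principal a ≡ principal b → a ⊑ b
  ≡-principal⁻ p = ⊆-principal⁻ (⊆-reflexive p)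

  -- A subgroup of the functions on B. The instances are the kernels of `H ℓ` and the functionals
  -- that vanish on a fixed vector.
  record IsAdditive (Q : (Fin n → ℤ) → Set) : Set where
    field
      resp  : ∀ {f g} → (∀ x → f x ≡ g x) → Q f → Q g
      zero∈ : Q (λ _ → + 0)
      add   : ∀ {f g} → Q f → Q g → Q (λ x → f x ℤ.+ g x)
      sub   : ∀ {f g} → Q f → Q g → Q (λ x → f x ℤ.- g x)

  module _ {Q : (Fin n → ℤ) → Set} (isAdditive : IsAdditive Q) where
    open IsAdditive isAdditive

    sum-closed : ∀ {m} (h : Fin m → Fin n → ℤ) → (∀ j → Q (h j)) → Q (λ x → sum (λ j → h j x))
    sum-closed {zero}  h q = zero∈
    sum-closed {suc m} h q = add (q zero) (sum-closed (h ∘ suc) (q ∘ suc))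

  δ : Fin n → Fin n → ℤ
  δ y x = if does (x ≟ y) then + 1 else + 0

  δ-refl : ∀ y → δ y y ≡ + 1
  δ-refl y rewrite dec-true (y ≟ y) refl = refl

  δ-≢ : ∀ {y x} → x ≢ y → δ y x ≡ + 0
  δ-≢ {y} {x} x≢y rewrite dec-false (x ≟ y) x≢y = refl

  sum-δ : ∀ (f : Fin n → ℤ) x → sum (λ y → f y ℤ.* δ y x) ≡ f x
  sum-δ f x = trans
    (sum-single x (λ y y≢x → trans (cong (f y ℤ.*_) (δ-≢ (y≢x ∘ sym))) (ℤ.*-zeroʳ (f y))))
    (trans (cong (f x ℤ.*_) (δ-refl x)) (ℤ.*-identityʳ (f x)))

  -- H ℓ is dual to left multiplication by the product of the 1 − b, b ∈ ℓ.
  H : List (Fin n) → (Fin n → ℤ) → Fin n → ℤ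
  H []      f = f
  H (b ∷ ℓ) f = H ℓ (λ x → f x ℤ.- f (b ∙ x))

  H-cong : ∀ ℓ {f g} → (∀ x → f x ≡ g x) → ∀ s → H ℓ f s ≡ H ℓ g s
  H-cong []      p s = p s
  H-cong (b ∷ ℓ) p s = H-cong ℓ (λ x → cong₂ ℤ._-_ (p x) (p (b ∙ x))) s

  H-+ : ∀ ℓ f g s → H ℓ (λ x → f x ℤ.+ g x) s ≡ H ℓ f s ℤ.+ H ℓ g s
  H-+ []      f g s = refl
  H-+ (b ∷ ℓ) f g s = trans
    (H-cong ℓ (λ x → rearrange (f x) (g x) (f (b ∙ x)) (g (b ∙ x))) s)
    (H-+ ℓ (λ x → f x ℤ.- f (b ∙ x)) (λ x → g x ℤ.- g (b ∙ x)) s)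
    where
    rearrange : ∀ i j k l → (i ℤ.+ j) ℤ.- (k ℤ.+ l) ≡ (i ℤ.- k) ℤ.+ (j ℤ.- l)
    rearrange = solve-∀

  H-* : ∀ ℓ a f s → H ℓ (λ x → a ℤ.* f x) s ≡ a ℤ.* H ℓ f s
  H-* []      a f s = refl
  H-* (b ∷ ℓ) a f s = trans
    (H-cong ℓ (λ x → rearrange a (f x) (f (b ∙ x))) s) (H-* ℓ a (λ x → f x ℤ.- f (b ∙ x)) s)
    where
    rearrange : ∀ a i j → a ℤ.* i ℤ.- a ℤ.* j ≡ a ℤ.* (i ℤ.- j)
    rearrange = solve-∀

  H-0 : ∀ ℓ {f} → (∀ x → f x ≡ + 0) → ∀ s → H ℓ f s ≡ + 0
  H-0 ℓ {f} z s = trans (H-cong ℓ z s) (H-* ℓ (+ 0) (λ _ → + 0) s)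

  H-∸ : ∀ ℓ f g s → H ℓ (λ x → f x ℤ.- g x) s ≡ H ℓ f s ℤ.- H ℓ g s
  H-∸ ℓ f g s = begin
    H ℓ (λ x → f x ℤ.- g x) s                ≡⟨ H-cong ℓ (λ x → cong (λ i → f x ℤ.+ i) (ℤ.-1*i≡-i (g x))) s ⟨
    H ℓ (λ x → f x ℤ.+ ℤ.-1ℤ ℤ.* g x) s      ≡⟨ H-+ ℓ f (λ x → ℤ.-1ℤ ℤ.* g x) s ⟩
    H ℓ f s ℤ.+ H ℓ (λ x → ℤ.-1ℤ ℤ.* g x) s  ≡⟨ cong (λ i → H ℓ f s ℤ.+ i) (trans (H-* ℓ ℤ.-1ℤ g s) (ℤ.-1*i≡-i _)) ⟩
    H ℓ f s ℤ.- H ℓ g s                      ∎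
    where open ≡-Reasoning

  H-kernel : ∀ ℓ → IsAdditive (λ f → ∀ s → H ℓ f s ≡ + 0)
  H-kernel ℓ = record
    { resp  = λ p q s → trans (sym (H-cong ℓ p s)) (q s)
    ; zero∈ = H-0 ℓ (λ _ → refl)
    ; add   = λ p q s → trans (H-+ ℓ _ _ s) (cong₂ ℤ._+_ (p s) (q s))
    ; sub   = λ p q s → trans (H-∸ ℓ _ _ s) (cong₂ ℤ._-_ (p s) (q s))
    }

  -- Left multiplication lowers supports: if bx lies above y, then so does x.
  H-support : ∀ ℓ {y f} → (∀ x → ¬ y ⊑ x → f x ≡ + 0) → ∀ s → ¬ y ⊑ s → H ℓ f s ≡ + 0
  H-support []      z = z
  H-support (b ∷ ℓ) z = H-support ℓ λ x ¬yx →
    cong₂ ℤ._-_ (z x ¬yx) (z (b ∙ x) (λ ybx → ¬yx (⊑-trans ybx (∙-⊑ʳ b x))))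

  -- Left and right multiplications commute.
  H-shift : ∀ ℓ f s a → H ℓ f (s ∙ a) ≡ H ℓ (λ x → f (x ∙ a)) s
  H-shift []      f s a = refl
  H-shift (b ∷ ℓ) f s a = trans (H-shift ℓ (λ x → f x ℤ.- f (b ∙ x)) s a)
    (H-cong ℓ (λ x → cong (λ z → f (x ∙ a) ℤ.- f z) (sym (assoc b x a))) s)

  -- c(1 − b) = 0 as soon as c ⊑ b, and c(1 − b) only involves elements below c otherwise.
  H-kills : ∀ {a} ℓ → a ∈ ℓ → ∀ {c} → c ⊑ a → ∀ (f : Fin n → ℤ) s → H ℓ (λ x → f (c ∙ x)) s ≡ + 0
  H-kills (a ∷ ℓ) (here refl) {c} ca f = H-0 ℓ λ x →
    trans (cong (λ z → f (c ∙ x) ℤ.- f z) (trans (sym (assoc c a x)) (cong (_∙ x) ca)))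
          (ℤ.+-inverseʳ (f (c ∙ x)))
  H-kills {a} (b ∷ ℓ) (there a∈ℓ) {c} ca f s = trans
    (H-cong ℓ (λ x → cong (λ z → f (c ∙ x) ℤ.- f z) (sym (assoc c b x))) s)
    (IsAdditive.sub (H-kernel ℓ) {λ x → f (c ∙ x)} {λ x → f (c ∙ b ∙ x)}
      (H-kills ℓ a∈ℓ ca f)
                    (H-kills ℓ a∈ℓ (⊑-trans (∙-⊑ˡ c b) ca) f) s)

  -- Every term of the expanded product other than 1 contains some b, so f - `H ℓ f` is an integral
  -- combination of translates of f.
  H-∸-closed : ∀ {Q} → IsAdditive Q → ∀ ℓ (f : Fin n → ℤ) → (∀ c → Q (λ x → f (c ∙ x))) →
               Q (λ x → f x ℤ.- H ℓ f x)
  H-∸-closed add []      f q = resp (λ x → sym (ℤ.+-inverseʳ (f x))) zero∈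
    where open IsAdditive add
  H-∸-closed {Q} isAdd (b ∷ ℓ) f q = resp (λ x → rearrange (f x) (f (b ∙ x)) (H ℓ f′ x))
    (add (H-∸-closed isAdd ℓ f′ λ c →
           resp (λ x → cong (λ z → f (c ∙ x) ℤ.- f z) (assoc b c x)) (sub (q c) (q (b ∙ c))))
         (q b))
    where
    open IsAdditive isAdd
    f′ : Fin n → ℤ
    f′ x = f x ℤ.- f (b ∙ x)
    rearrange : ∀ i j k → ((i ℤ.- j) ℤ.- k) ℤ.+ j ≡ i ℤ.- k
    rearrange = solve-∀

  𝓗 : (Fin n → ℤ) → Fin n → ℤ
  𝓗 = H (allFin n)

  𝓗-kills : ∀ c (f : Fin n → ℤ) s → 𝓗 (λ x → f (c ∙ x)) s ≡ + 0
  𝓗-kills c f s = H-kills (allFin n) (∈-allFin c) ⊑-refl f s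

  -- f - `𝓗 f` is a combination of translates of f, and `𝓗` kills all of these.
  𝓗-idem : ∀ f s → 𝓗 (𝓗 f) s ≡ 𝓗 f s
  𝓗-idem f s = sym (ℤ.i-j≡0⇒i≡j _ _ (trans (sym (H-∸ (allFin n) f (𝓗 f) s))
    (H-∸-closed (H-kernel (allFin n)) (allFin n) f (λ c → 𝓗-kills c f) s)))

  𝓗-decompose : ∀ f → (∀ y → f y ≢ + 0 → ∀ s → 𝓗 (δ y) s ≡ + 0) → ∀ s → 𝓗 f s ≡ + 0
  𝓗-decompose f z = IsAdditive.resp (H-kernel (allFin n)) (sum-δ f)
    (sum-closed (H-kernel (allFin n)) (λ y x → f y ℤ.* δ y x) term)
    where
    term : ∀ y s → 𝓗 (λ x → f y ℤ.* δ y x) s ≡ + 0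
    term y s with f y ℤ.≟ + 0
    ... | yes p = trans (H-* (allFin n) (f y) (δ y) s) (cong (ℤ._* 𝓗 (δ y) s) p)
    ... | no ¬p = trans (H-* (allFin n) (f y) (δ y) s)
                        (trans (cong (f y ℤ.*_) (z y ¬p s)) (ℤ.*-zeroʳ (f y)))

  module _ (connected : Connected) where

    -- By induction from the top, 𝓗 δ_y is constant on comparable elements of ↑y, hence on ↑y
    -- by connectedness, so it is a multiple of δ_y · y, which 𝓗 kills; but 𝓗 is idempotent.
    𝓗-δ : ∀ y → Acc (flip _⊏_) y → ∀ s → 𝓗 (δ y) s ≡ + 0
    𝓗-δ y (acc rec) s = begin
      g s                              ≡⟨ 𝓗-idem (δ y) s ⟨
      𝓗 g s                            ≡⟨ H-cong (allFin n) g-multiple s ⟩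
      𝓗 (λ x → g y ℤ.* δ y (y ∙ x)) s  ≡⟨ H-* (allFin n) (g y) (λ x → δ y (y ∙ x)) s ⟩
      g y ℤ.* 𝓗 (λ x → δ y (y ∙ x)) s  ≡⟨ cong (g y ℤ.*_) (𝓗-kills y (δ y) s) ⟩
      g y ℤ.* + 0                      ≡⟨ ℤ.*-zeroʳ (g y) ⟩
      + 0                              ∎
      where
      open ≡-Reasoning
      g : Fin n → ℤ
      g = 𝓗 (δ y)

      strictly-above : ∀ (f : Fin n → ℤ) → (∀ x → ¬ y ⊏ x → f x ≡ + 0) → ∀ t → 𝓗 f t ≡ + 0
      strictly-above f z = 𝓗-decompose f λ x fx≢0 → case x fx≢0
        where
        case : ∀ x → f x ≢ + 0 → ∀ t → 𝓗 (δ x) t ≡ + 0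
        case x fx≢0 with y ⊏? x
        ... | yes y⊏x = 𝓗-δ x (rec y⊏x)
        ... | no ¬y⊏x = contradiction (z x ¬y⊏x) fx≢0

      -- Right translation by a changes δ_y only strictly above y, where the induction hypothesis
      -- applies. Indeed xa = y forces y ⊑ x; if moreover x ⊑ y, then x ⊑ a, so x = xa = y.
      shifted-δ : ∀ {a} → y ⊑ a → ∀ x → ¬ y ⊏ x → δ y (x ∙ a) ℤ.- δ y x ≡ + 0
      shifted-δ {a} ya x ¬y⊏x with x ≟ y
      ... | yes refl = trans (cong (ℤ._- + 1) (trans (cong (δ y) ya) (δ-refl y))) refl
      ... | no x≢y with x ∙ a ≟ y
      ...   | no _ = refl
      ...   | yes xa≡y with x ⊑? y
      ...     | yes xy = contradiction (trans (sym (⊑-trans xy ya)) xa≡y) x≢y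
      ...     | no ¬xy = contradiction (subst (_⊑ x) xa≡y (∙-⊑ˡ x a) , ¬xy) ¬y⊏x

      below : ∀ {a b} → y ⊑ a → a ≤B b → g a ≡ g b
      below {a} {b} ya ba = begin
        g a                            ≡⟨ cong g ba ⟨
        g (b ∙ a)                      ≡⟨ H-shift (allFin n) (δ y) b a ⟩
        𝓗 (λ x → δ y (x ∙ a)) b        ≡⟨ ℤ.i-j≡0⇒i≡j _ _ (trans
          (sym (H-∸ (allFin n) (λ x → δ y (x ∙ a)) (δ y) b))
          (strictly-above (λ x → δ y (x ∙ a) ℤ.- δ y x) (shifted-δ ya) b)) ⟩
        g b                            ∎

      constant : ∀ {a b} → y ⊑ a → Zigzag (principal y) a b → g a ≡ g b
      constant ya here = refl
      constant ya (step y⊆b (inj₁ a≤b) z) = trans (below ya a≤b) (constant (⊆-principal⁻ y⊆b) z)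
      constant ya (step y⊆b (inj₂ b≤a) z) =
        trans (sym (below (⊆-principal⁻ y⊆b) b≤a)) (constant (⊆-principal⁻ y⊆b) z)

      -- x ↦ `δ y (y ∙ x)` is the indicator of the elements above y, and at the same time a
      -- translate of δ_y.
      g-multiple : ∀ x → g x ≡ g y ℤ.* δ y (y ∙ x)
      g-multiple x with y ∙ x ≟ y
      ... | yes yx = trans
        (constant yx (connected (principal y) (y , refl) x y (⊆-principal⁺ yx) (⊆-principal⁺ ⊑-refl)))
        (sym (ℤ.*-identityʳ (g y)))
      ... | no ¬yx = trans
        (H-support (allFin n) (λ z ¬yz → δ-≢ (λ z≡y → ¬yz (subst (y ⊑_) (sym z≡y) ⊑-refl))) x ¬yx)
        (sym (ℤ.*-zeroʳ (g y)))

    -- `𝓗` vanishes on every δ_y, hence everywhere, so f equals f - `𝓗 f`. This is unitality in dual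
    -- form.
    translates-span : ∀ {Q} → IsAdditive Q → ∀ (f : Fin n → ℤ) → (∀ c → Q (λ x → f (c ∙ x))) → Q f
    translates-span isAdd f q = IsAdditive.resp isAdd
      (λ x → trans (cong (λ i → f x ℤ.- i) (𝓗-decompose f (λ y _ → 𝓗-δ y (⊏-noetherian y)) x))
                   (ℤ.+-identityʳ (f x)))
      (H-∸-closed isAdd (allFin n) f q)

lookup-injective : ∀ {a} {A : Set a} {xs : List A} → Unique xs → ∀ {i j} → lookup xs i ≡ lookup xs j → i ≡ j
lookup-injective (_ ∷ _)   {zero}  {zero}  _  = ≡.refl
lookup-injective (x∉ ∷ _)  {zero}  {suc j} eq = contradiction eq (All.lookup x∉ (∈-lookup j))
lookup-injective (x∉ ∷ _)  {suc i} {zero}  eq = contradiction (≡.sym eq) (All.lookup x∉ (∈-lookup i))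
lookup-injective (_ ∷ xs!) {suc i} {suc j} eq = ≡.cong suc (lookup-injective xs! eq)

-- The descending flag of direct summands of ℤL_Y.

module IntegralFlags {n : ℕ} (B : LRB n) (y : Fin n) where
  open ≡ using (refl; sym; trans; cong; cong₂; subst; module ≡-Reasoning)
  open ℤΣ
  open LRB B
  open LRBNotions B
  open Support B

  Y : Subset n
  Y = principal y

  cut : (Fin n → ℤ) → Fin n → ℤ
  cut f x = if does (principal x ≟S Y) then f x else + 0

  -- The action on functions dual to the one on 𝕜L_Y.
  infixl 7 _◂_
  _◂_ : (Fin n → ℤ) → Fin n → Fin n → ℤ
  (f ◂ b) x = if does (Y ⊆? principal b) then cut (λ z → f (b ∙ z)) x else + 0

  χ′ : Fin n → Fin n → ℤ
  χ′ b a = if does (principal b ⊆? principal a) then + 1 else + 0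

  L-∙⁺ : ∀ {b x} → Y ⊆ principal b → principal x ≡ Y → principal (b ∙ x) ≡ Y
  L-∙⁺ {b} {x} Yb xY = ≡-principal⁺
    (⊑-trans (∙-⊑ʳ b x) (≡-principal⁻ xY))
    (∙-greatest (⊆-principal⁻ Yb) (≡-principal⁻ (sym xY)))

  L-∙⁻ : ∀ {b x} → principal (b ∙ x) ≡ Y → Y ⊆ principal b
  L-∙⁻ {b} {x} p = ⊆-principal⁺ (⊑-trans (≡-principal⁻ (sym p)) (∙-⊑ˡ b x))

  cut-∸ : ∀ f a g x → cut (λ z → f z ℤ.- a ℤ.* g z) x ≡ cut f x ℤ.- a ℤ.* cut g x
  cut-∸ f a g x with does (principal x ≟S Y)
  ... | true  = refl
  ... | false = cong (λ i → + 0 ℤ.- i) (sym (ℤ.*-zeroʳ a))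

  ◂-∸ : ∀ f a g b x → ((λ z → f z ℤ.- a ℤ.* g z) ◂ b) x ≡ (f ◂ b) x ℤ.- a ℤ.* (g ◂ b) x
  ◂-∸ f a g b x with does (Y ⊆? principal b)
  ... | true  = cut-∸ (λ z → f (b ∙ z)) a (λ z → g (b ∙ z)) x
  ... | false = cong (λ i → + 0 ℤ.- i) (sym (ℤ.*-zeroʳ a))

  ◂-∙ : ∀ f a b x → (f ◂ a ◂ b) x ≡ (f ◂ (a ∙ b)) x
  ◂-∙ f a b x with Y ⊆? principal b
  ... | no ¬Yb
    rewrite dec-false (Y ⊆? principal (a ∙ b))
      (λ p → ¬Yb (⊆-principal⁺ (⊑-trans (⊆-principal⁻ p) (∙-⊑ʳ a b)))) = refl
  ... | yes Yb with Y ⊆? principal a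
  ...   | no ¬Ya
    rewrite dec-false (Y ⊆? principal (a ∙ b))
      (λ p → ¬Ya (⊆-principal⁺ (⊑-trans (⊆-principal⁻ p) (∙-⊑ˡ a b))))
    with does (principal x ≟S Y)
  ...     | true  = refl
  ...     | false = refl
  ◂-∙ f a b x | yes Yb | yes Ya
    rewrite dec-true (Y ⊆? principal (a ∙ b))
      (⊆-principal⁺ (∙-greatest (⊆-principal⁻ Ya) (⊆-principal⁻ Yb)))
    with principal x ≟S Y
  ... | no _   = refl
  ... | yes xY rewrite dec-true (principal (b ∙ x) ≟S Y) (L-∙⁺ Yb xY) = cong f (sym (assoc a b x))

  ⟪◂-∸⟫ : ∀ f a g b w → ⟪ (λ z → f z ℤ.- a ℤ.* g z) ◂ b , w ⟫ ≡ ⟪ f ◂ b , w ⟫ ℤ.- a ℤ.* ⟪ g ◂ b , w ⟫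
  ⟪◂-∸⟫ f a g b w = trans (⟪⟫-cong (◂-∸ f a g b) (λ _ → refl)) (⟪⟫-∸ˡ (f ◂ b) a (g ◂ b) w)

  -- Summands are accessed only through these functionals: closure under B and, later, membership
  -- over 𝕜 can be read off them without division.
  Ann : ∀ {r} → (Fin r → Fin n → ℤ) → (Fin n → ℤ) → Set
  Ann w h = ∀ j → ⟪ h , w j ⟫ ≡ + 0

  -- The span of the w j is a direct summand of ℤL_Y, with dual basis g, and a submodule.
  record State (r : ℕ) : Set where
    field
      g w    : Fin r → Fin n → ℤ
      diag   : ∀ i → ⟪ g i , w i ⟫ ≡ + 1
      off    : ∀ {i j} → i ≢ j → ⟪ g i , w j ⟫ ≡ + 0
      supp   : ∀ j x → principal x ≢ Y → w j x ≡ + 0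
      closed : ∀ h → Ann w h → ∀ b → Ann w (h ◂ b)
  open State public

  -- A direct summand is the common kernel of the functionals that annihilate it, so this says that
  -- the two families have the same span.
  SameAnn : ∀ {r r′} → State r → State r′ → Set
  SameAnn s s′ = ∀ h → (Ann (w s) h → Ann (w s′) h) × (Ann (w s′) h → Ann (w s) h)

  SameAnn-trans : ∀ {r r′ r″} {s : State r} {s′ : State r′} {s″ : State r″} →
                  SameAnn s s′ → SameAnn s′ s″ → SameAnn s s″
  SameAnn-trans p q h = proj₁ (q h) ∘ proj₁ (p h) , proj₂ (p h) ∘ proj₂ (q h)

  swap : ∀ {r} (s : State (suc r)) (k : Fin (suc r)) →
         ∃ λ (s′ : State (suc r)) → SameAnn s s′ × (∀ j → w s′ j ≡ w s (transpose zero k j))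
  swap s k = record
    { g      = g s ∘ τ
    ; w      = w s ∘ τ
    ; diag   = diag s ∘ τ
    ; off    = λ {i} {j} i≢j → off s λ eq → i≢j
        (trans (sym (transpose-inverse k zero)) (trans (cong τ⁻¹ eq) (transpose-inverse k zero)))
    ; supp   = supp s ∘ τ
    ; closed = λ h p b j → closed s h (back h p) b (τ j)
    } , (λ h → (λ p j → p (τ j)) , back h) , λ j → refl
    where
    τ τ⁻¹ : Fin (suc _) → Fin (suc _)
    τ = transpose zero k
    τ⁻¹ = transpose k zero
    back : ∀ h → Ann (w s ∘ τ) h → Ann (w s) h
    back h p j = subst (λ i → ⟪ h , w s i ⟫ ≡ + 0) (transpose-inverse zero k) (p (τ⁻¹ j))

  -- An elementary unimodular change of basis: multiples of the first vector are subtracted from the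
  -- others, and the dual basis changes contragrediently.
  module Shear {r} (s : State (suc r)) (q : Fin r → ℤ) where
    w′ g′ : Fin (suc r) → Fin n → ℤ
    w′ zero      = w s zero
    w′ (suc j) x = w s (suc j) x ℤ.- q j ℤ.* w s zero x
    g′ zero x    = g s zero x ℤ.+ sum (λ j → q j ℤ.* g s (suc j) x)
    g′ (suc j)   = g s (suc j)

    row : ∀ f j → ⟪ f , w′ (suc j) ⟫ ≡ ⟪ f , w s (suc j) ⟫ ℤ.- q j ℤ.* ⟪ f , w s zero ⟫
    row f j = ⟪⟫-∸ʳ f (w s (suc j)) (q j) (w s zero)

    to : ∀ h → Ann (w s) h → Ann w′ h
    to h p zero    = p zero
    to h p (suc j) = trans (row h j)
      (trans (cong₂ (λ i k → i ℤ.- q j ℤ.* k) (p (suc j)) (p zero)) (cong (λ i → + 0 ℤ.- i) (ℤ.*-zeroʳ (q j))))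

    from : ∀ h → Ann w′ h → Ann (w s) h
    from h p zero    = p zero
    from h p (suc j) = begin
      ⟪ h , w s (suc j) ⟫               ≡⟨ ℤ.i-j≡0⇒i≡j _ _ (trans (sym (row h j)) (p (suc j))) ⟩
      q j ℤ.* ⟪ h , w s zero ⟫          ≡⟨ cong (q j ℤ.*_) (p zero) ⟩
      q j ℤ.* + 0                       ≡⟨ ℤ.*-zeroʳ (q j) ⟩
      + 0                               ∎
      where open ≡-Reasoning

    tail-row : ∀ i j → ⟪ g s (suc i) , w′ (suc j) ⟫ ≡ ⟪ g s (suc i) , w s (suc j) ⟫
    tail-row i j = begin
      ⟪ g s (suc i) , w′ (suc j) ⟫
        ≡⟨ row (g s (suc i)) j ⟩
      ⟪ g s (suc i) , w s (suc j) ⟫ ℤ.- q j ℤ.* ⟪ g s (suc i) , w s zero ⟫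
        ≡⟨ cong (λ k → ⟪ g s (suc i) , w s (suc j) ⟫ ℤ.- q j ℤ.* k) (off s λ ()) ⟩
      ⟪ g s (suc i) , w s (suc j) ⟫ ℤ.- q j ℤ.* + 0
        ≡⟨ lemma ⟪ g s (suc i) , w s (suc j) ⟫ (q j) ⟩
      ⟪ g s (suc i) , w s (suc j) ⟫ ∎
      where
      open ≡-Reasoning
      lemma : ∀ i q → i ℤ.- q ℤ.* + 0 ≡ i
      lemma = solve-∀

    head-row : ∀ v → ⟪ g′ zero , v ⟫ ≡ ⟪ g s zero , v ⟫ ℤ.+ sum (λ j → q j ℤ.* ⟪ g s (suc j) , v ⟫)
    head-row v = trans (⟪⟫-+ˡ (g s zero) (λ x → sum (λ j → q j ℤ.* g s (suc j) x)) v)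
      (cong (λ i → ⟪ g s zero , v ⟫ ℤ.+ i) (⟪⟫-sumˡ q (g s ∘ suc) v))

    diag′ : ∀ i → ⟪ g′ i , w′ i ⟫ ≡ + 1
    diag′ zero = trans (head-row (w s zero)) (cong₂ ℤ._+_ (diag s zero)
      (sum-zero (λ j → trans (cong (q j ℤ.*_) (off s λ ())) (ℤ.*-zeroʳ (q j)))))
    diag′ (suc j) = trans (tail-row j j) (diag s (suc j))

    off′ : ∀ {i j} → i ≢ j → ⟪ g′ i , w′ j ⟫ ≡ + 0
    off′ {zero}  {zero}  i≢j = contradiction refl i≢j
    off′ {suc i} {zero}  i≢j = off s i≢j
    off′ {suc i} {suc j} i≢j = trans (tail-row i j) (off s i≢j)
    off′ {zero}  {suc j} _   = begin
      ⟪ g′ zero , w′ (suc j) ⟫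
        ≡⟨ head-row (w′ (suc j)) ⟩
      ⟪ g s zero , w′ (suc j) ⟫ ℤ.+ sum (λ i → q i ℤ.* ⟪ g s (suc i) , w′ (suc j) ⟫)
        ≡⟨ cong₂ ℤ._+_
             (trans (row (g s zero) j) (cong₂ (λ i k → i ℤ.- q j ℤ.* k) (off s λ ()) (diag s zero)))
             (sum-single j λ i i≢j → trans
               (cong (q i ℤ.*_) (trans (tail-row i j) (off s (i≢j ∘ suc-injective)))) (ℤ.*-zeroʳ (q i))) ⟩
      (+ 0 ℤ.- q j ℤ.* + 1) ℤ.+ q j ℤ.* ⟪ g s (suc j) , w′ (suc j) ⟫
        ≡⟨ cong (λ k → (+ 0 ℤ.- q j ℤ.* + 1) ℤ.+ q j ℤ.* k) (diag′ (suc j)) ⟩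
      (+ 0 ℤ.- q j ℤ.* + 1) ℤ.+ q j ℤ.* + 1
        ≡⟨ lemma (q j) ⟩
      + 0 ∎
      where
      open ≡-Reasoning
      lemma : ∀ q → (+ 0 ℤ.- q ℤ.* + 1) ℤ.+ q ℤ.* + 1 ≡ + 0
      lemma = solve-∀

    supp′ : ∀ j x → principal x ≢ Y → w′ j x ≡ + 0
    supp′ zero    x x∉ = supp s zero x x∉
    supp′ (suc j) x x∉ = trans (cong₂ (λ i k → i ℤ.- q j ℤ.* k) (supp s (suc j) x x∉) (supp s zero x x∉))
                               (cong (λ i → + 0 ℤ.- i) (ℤ.*-zeroʳ (q j)))

    state : State (suc r)
    state = record { g = g′ ; w = w′ ; diag = diag′ ; off = off′ ; supp = supp′
                   ; closed = λ h p b → to (h ◂ b) (closed s h (from h p) b) }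

    same : SameAnn s state
    same h = to h , from h

  -- The remaining nonzero value is, up to sign, the content of f on the span, where f is now this
  -- multiple of the first dual vector.
  Aligned : ∀ {r} → State (suc r) → (Fin n → ℤ) → Set
  Aligned {r} s f = ∃ λ (s′ : State (suc r)) →
    SameAnn s s′ × ⟪ f , w s′ zero ⟫ ≢ + 0 × (∀ j → ⟪ f , w s′ (suc j) ⟫ ≡ + 0)

  -- The Euclidean algorithm on the values ⟪ f , w j ⟫.
  align-head : ∀ {r} (s : State (suc r)) f → ⟪ f , w s zero ⟫ ≢ + 0 →
               Acc ℕ._<_ ℤ.∣ ⟪ f , w s zero ⟫ ∣ → Aligned s f
  align-head {r} s f d≢0 (acc rec) = go (any? (λ j → ¬? (⟪ f , w sheared (suc j) ⟫ ℤ.≟ + 0)))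
    where
    d : ℤ
    d = ⟪ f , w s zero ⟫
    instance
      d-nonZero : ℤ.NonZero d
      d-nonZero = ℤ.≢-nonZero d≢0
    q : Fin r → ℤ
    q j = ⟪ f , w s (suc j) ⟫ ℤ./ d
    module S = Shear s q
    sheared : State (suc r)
    sheared = S.state
    remainder : ∀ j → ⟪ f , w sheared (suc j) ⟫ ≡ + (⟪ f , w s (suc j) ⟫ ℤ.% d)
    remainder j = trans (S.row f j)
      (trans (cong (ℤ._- q j ℤ.* d) (ℤ.a≡a%n+[a/n]*n ⟪ f , w s (suc j) ⟫ d))
             (lemma (+ (⟪ f , w s (suc j) ⟫ ℤ.% d)) (q j ℤ.* d)))
      where
      lemma : ∀ i k → i ℤ.+ k ℤ.- k ≡ i
      lemma = solve-∀
    go : Dec (∃ λ j → ⟪ f , w sheared (suc j) ⟫ ≢ + 0) → Aligned s f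
    go (no none) = sheared , S.same , d≢0 , λ j →
      decidable-stable (⟪ f , w sheared (suc j) ⟫ ℤ.≟ + 0) (λ p → none (j , p))
    go (yes (j , r≢0)) with swap sheared (suc j)
    ... | s₂ , same₂ , w₂ = let s₃ , same₃ , rest = align-head s₂ f
                                  (subst (λ v → ⟪ f , v ⟫ ≢ + 0) (sym (w₂ zero)) r≢0) (rec smaller)
                            in s₃ , SameAnn-trans {s = s} {sheared} {s₃} S.same
                                      (SameAnn-trans {s = sheared} {s₂} {s₃} same₂ same₃) , rest
      where
      smaller : ℤ.∣ ⟪ f , w s₂ zero ⟫ ∣ ℕ.< ℤ.∣ d ∣
      smaller rewrite w₂ zero | remainder j = ℤ.n%d<d ⟪ f , w s (suc j) ⟫ d

  align : ∀ {r} (s : State (suc r)) f → (∃ λ j → ⟪ f , w s j ⟫ ≢ + 0) → Aligned s f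
  align s f (j , p) with swap s j
  ... | s₁ , same₁ , w₁ =
    let s₂ , same₂ , rest = align-head s₁ f (subst (λ v → ⟪ f , v ⟫ ≢ + 0) (sym (w₁ zero)) p)
                                       (ℕ.<-wellFounded _)
    in s₂ , SameAnn-trans {s = s} {s₁} {s₂} same₁ same₂ , rest

  module Split {r} (s : State (suc r)) (b₀ : Fin n) (f : Fin n → ℤ)
               (d≢0 : ⟪ f , w s zero ⟫ ≢ + 0) (f-row : ∀ j → ⟪ f , w s (suc j) ⟫ ≡ + 0)
               (f-eigen : ∀ a j → ⟪ f ◂ a , w s j ⟫ ≡ χ′ b₀ a ℤ.* ⟪ f , w s j ⟫) where
    d : ℤ
    d = ⟪ f , w s zero ⟫

    residue-ann : Ann (w s) (λ z → f z ℤ.- d ℤ.* g s zero z)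
    residue-ann zero = trans (⟪⟫-∸ˡ f d (g s zero) (w s zero))
      (trans (cong (λ k → d ℤ.- d ℤ.* k) (diag s zero)) (lemma d))
      where
      lemma : ∀ d → d ℤ.- d ℤ.* + 1 ≡ + 0
      lemma = solve-∀
    residue-ann (suc j) = trans (⟪⟫-∸ˡ f d (g s zero) (w s (suc j)))
      (trans (cong₂ (λ i k → i ℤ.- d ℤ.* k) (f-row j) (off s λ ()))
             (cong (λ i → + 0 ℤ.- i) (ℤ.*-zeroʳ d)))

    -- With d the value of f at the first vector, f - d g₀ annihilates the span, and so do its
    -- translates. The eigenvector equation of f is therefore d times that of g₀, and d cancels in
    -- ℤ.
    eigen : ∀ a j → ⟪ g s zero ◂ a , w s j ⟫ ≡ χ′ b₀ a ℤ.* ⟪ g s zero , w s j ⟫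
    eigen a j = ℤ.*-cancelˡ-≡ d _ _ {{ℤ.≢-nonZero d≢0}} (begin
      d ℤ.* ⟪ g s zero ◂ a , w s j ⟫          ≡⟨ ℤ.i-j≡0⇒i≡j _ _ (trans
        (sym (⟪◂-∸⟫ f d (g s zero) a (w s j))) (closed s (λ z → f z ℤ.- d ℤ.* g s zero z) residue-ann a j)) ⟨
      ⟪ f ◂ a , w s j ⟫                        ≡⟨ f-eigen a j ⟩
      χ′ b₀ a ℤ.* ⟪ f , w s j ⟫                ≡⟨ cong (χ′ b₀ a ℤ.*_) (ℤ.i-j≡0⇒i≡j _ _ (trans
        (sym (⟪⟫-∸ˡ f d (g s zero) (w s j))) (residue-ann j))) ⟩
      χ′ b₀ a ℤ.* (d ℤ.* ⟪ g s zero , w s j ⟫) ≡⟨ lemma (χ′ b₀ a) d ⟪ g s zero , w s j ⟫ ⟩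
      d ℤ.* (χ′ b₀ a ℤ.* ⟪ g s zero , w s j ⟫) ∎)
      where
      open ≡-Reasoning
      lemma : ∀ c d k → c ℤ.* (d ℤ.* k) ≡ d ℤ.* (c ℤ.* k)
      lemma = solve-∀

    -- On the span, such an h is a multiple of g₀. Thus B acts on h through the character of g₀,
    -- which yields both the closure of `rest` and `head-act`.
    remove-head : ∀ h → Ann (w s ∘ suc) h →
                  Ann (w s) (λ z → h z ℤ.- ⟪ h , w s zero ⟫ ℤ.* g s zero z)
    remove-head h p zero = trans (⟪⟫-∸ˡ h ⟪ h , w s zero ⟫ (g s zero) (w s zero))
      (trans (cong (λ k → ⟪ h , w s zero ⟫ ℤ.- ⟪ h , w s zero ⟫ ℤ.* k) (diag s zero))
             (lemma ⟪ h , w s zero ⟫))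
      where
      lemma : ∀ d → d ℤ.- d ℤ.* + 1 ≡ + 0
      lemma = solve-∀
    remove-head h p (suc j) = trans (⟪⟫-∸ˡ h ⟪ h , w s zero ⟫ (g s zero) (w s (suc j)))
      (trans (cong₂ (λ i k → i ℤ.- ⟪ h , w s zero ⟫ ℤ.* k) (p j) (off s λ ()))
             (cong (λ i → + 0 ℤ.- i) (ℤ.*-zeroʳ ⟪ h , w s zero ⟫)))

    action-on-rest : ∀ h → Ann (w s ∘ suc) h → ∀ b j →
      ⟪ h ◂ b , w s j ⟫ ≡ ⟪ h , w s zero ⟫ ℤ.* ⟪ g s zero ◂ b , w s j ⟫
    action-on-rest h p b j = ℤ.i-j≡0⇒i≡j _ _ (trans
      (sym (⟪◂-∸⟫ h ⟪ h , w s zero ⟫ (g s zero) b (w s j)))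
      (closed s (λ z → h z ℤ.- ⟪ h , w s zero ⟫ ℤ.* g s zero z) (remove-head h p) b j))

    head-act : ∀ h → Ann (w s ∘ suc) h → ∀ b →
               ⟪ h ◂ b , w s zero ⟫ ≡ χ′ b₀ b ℤ.* ⟪ h , w s zero ⟫
    head-act h p b = begin
      ⟪ h ◂ b , w s zero ⟫
        ≡⟨ action-on-rest h p b zero ⟩
      ⟪ h , w s zero ⟫ ℤ.* ⟪ g s zero ◂ b , w s zero ⟫
        ≡⟨ cong (λ i → ⟪ h , w s zero ⟫ ℤ.* i) (eigen b zero) ⟩
      ⟪ h , w s zero ⟫ ℤ.* (χ′ b₀ b ℤ.* ⟪ g s zero , w s zero ⟫)
        ≡⟨ cong (λ k → ⟪ h , w s zero ⟫ ℤ.* (χ′ b₀ b ℤ.* k)) (diag s zero) ⟩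
      ⟪ h , w s zero ⟫ ℤ.* (χ′ b₀ b ℤ.* + 1)
        ≡⟨ lemma ⟪ h , w s zero ⟫ (χ′ b₀ b) ⟩
      χ′ b₀ b ℤ.* ⟪ h , w s zero ⟫ ∎
      where
      open ≡-Reasoning
      lemma : ∀ i k → i ℤ.* (k ℤ.* + 1) ≡ k ℤ.* i
      lemma = solve-∀

    rest : State r
    rest = record
      { g      = g s ∘ suc
      ; w      = w s ∘ suc
      ; diag   = diag s ∘ suc
      ; off    = λ i≢j → off s (i≢j ∘ suc-injective)
      ; supp   = supp s ∘ suc
      ; closed = λ h p b j → begin
          ⟪ h ◂ b , w s (suc j) ⟫
            ≡⟨ action-on-rest h p b (suc j) ⟩
          ⟪ h , w s zero ⟫ ℤ.* ⟪ g s zero ◂ b , w s (suc j) ⟫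
            ≡⟨ cong (λ i → ⟪ h , w s zero ⟫ ℤ.* i) (eigen b (suc j)) ⟩
          ⟪ h , w s zero ⟫ ℤ.* (χ′ b₀ b ℤ.* ⟪ g s zero , w s (suc j) ⟫)
            ≡⟨ cong (λ k → ⟪ h , w s zero ⟫ ℤ.* (χ′ b₀ b ℤ.* k)) (off s λ ()) ⟩
          ⟪ h , w s zero ⟫ ℤ.* (χ′ b₀ b ℤ.* + 0)
            ≡⟨ lemma ⟪ h , w s zero ⟫ (χ′ b₀ b) ⟩
          + 0 ∎
      }
      where
      open ≡-Reasoning
      lemma : ∀ i k → i ℤ.* (k ℤ.* + 0) ≡ + 0
      lemma = solve-∀

  module Step (connected : Connected) {r} (s : State (suc r)) where
    Active : Fin n → Set
    Active b = ∃ λ j → ⟪ g s zero ◂ b , w s j ⟫ ≢ + 0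

    active? : ∀ b → Dec (Active b)
    active? b = any? (λ j → ¬? (⟪ g s zero ◂ b , w s j ⟫ ℤ.≟ + 0))

    inactive : ∀ {b} → ¬ Active b → Ann (w s) (g s zero ◂ b)
    inactive {b} ¬p j = decidable-stable (⟪ g s zero ◂ b , w s j ⟫ ℤ.≟ + 0) (λ p → ¬p (j , p))

    -- On vectors supported in L_Y the dual action is plain translation of the truncated function,
    -- because bx leaves L_Y exactly when Bb does not contain Y. This makes `translates-span`
    -- applicable.
    cut-translate : ∀ f v → (∀ x → principal x ≢ Y → v x ≡ + 0) →
                    ∀ c → ⟪ f ◂ c , v ⟫ ≡ ⟪ (λ x → cut f (c ∙ x)) , v ⟫
    cut-translate f v v-supp c = sum-cong-≗ term
      where
      term : ∀ x → (f ◂ c) x ℤ.* v x ≡ cut f (c ∙ x) ℤ.* v x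
      term x with principal x ≟S Y
      ... | no x∉ rewrite v-supp x x∉ =
        trans (ℤ.*-zeroʳ (if does (Y ⊆? principal c) then + 0 else + 0)) (sym (ℤ.*-zeroʳ (cut f (c ∙ x))))
      ... | yes x∈ with Y ⊆? principal c
      ...   | yes Yc rewrite dec-true (principal (c ∙ x) ≟S Y) (L-∙⁺ Yc x∈) = refl
      ...   | no ¬Yc rewrite dec-false (principal (c ∙ x) ≟S Y) (λ p → ¬Yc (L-∙⁻ p)) = refl

    cut-pair : ∀ f v → (∀ x → principal x ≢ Y → v x ≡ + 0) → ⟪ cut f , v ⟫ ≡ ⟪ f , v ⟫
    cut-pair f v v-supp = sum-cong-≗ term
      where
      term : ∀ x → cut f x ℤ.* v x ≡ f x ℤ.* v x
      term x with principal x ≟S Y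
      ... | yes _ = refl
      ... | no x∉ rewrite v-supp x x∉ = sym (ℤ.*-zeroʳ (f x))

    annihilator : ∀ v → IsAdditive (λ f → ⟪ f , v ⟫ ≡ + 0)
    annihilator v = record
      { resp  = λ p q → trans (⟪⟫-cong (λ x → sym (p x)) (λ _ → refl)) q
      ; zero∈ = sum-zero {n} (λ _ → refl)
      ; add   = λ {f} {g} p q → trans (⟪⟫-+ˡ f g v) (cong₂ ℤ._+_ p q)
      ; sub   = λ {f} {g} p q → trans (⟪⟫-+ˡ f (λ x → ℤ.- g x) v)
                  (cong₂ ℤ._+_ p (trans (⟪⟫-negˡ g v) (cong (λ i → ℤ.- i) q)))
      }

    -- If all translates of g₀ annihilated the span, then so would g₀, an integral combination of
    -- them on this span; but its value at the first vector is 1.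
    some-active : ∃ Active
    some-active with any? active?
    ... | yes p = p
    ... | no ¬p = contradiction
      (trans (sym (diag s zero)) (trans (sym (cut-pair (g s zero) (w s zero) (supp s zero)))
        (translates-span connected (annihilator (w s zero)) (cut (g s zero)) λ c →
          trans (sym (cut-translate (g s zero) (w s zero) (supp s zero) c))
                (inactive (λ q → ¬p (c , q)) zero))))
      λ ()

    minimal-active : ∀ b → Acc _⊏_ b → Active b → ∃ λ b₀ → Active b₀ × (∀ c → c ⊏ b₀ → ¬ Active c)
    minimal-active b (acc rec) p with any? (λ c → (c ⊏? b) ×-dec active? c)
    ... | yes (c , c⊏b , q) = minimal-active c (rec c⊏b) q
    ... | no none = b , p , λ c c⊏b q → none (c , c⊏b , q)

    row-eigen : ∀ b₀ → (∀ c → c ⊏ b₀ → ¬ Active c) → (s′ : State (suc r)) → SameAnn s s′ →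
                ∀ a j → ⟪ g s zero ◂ b₀ ◂ a , w s′ j ⟫ ≡ χ′ b₀ a ℤ.* ⟪ g s zero ◂ b₀ , w s′ j ⟫
    row-eigen b₀ least s′ same a j with principal b₀ ⊆? principal a
    ... | yes b₀a = begin
      ⟪ g s zero ◂ b₀ ◂ a , w s′ j ⟫                 ≡⟨ ⟪⟫-cong (◂-∙ (g s zero) b₀ a) (λ _ → refl) ⟩
      ⟪ g s zero ◂ (b₀ ∙ a) , w s′ j ⟫   ≡⟨ cong (λ b → ⟪ g s zero ◂ b , w s′ j ⟫) (⊆-principal⁻ b₀a) ⟩
      ⟪ g s zero ◂ b₀ , w s′ j ⟫                     ≡⟨ ℤ.*-identityˡ _ ⟨
      + 1 ℤ.* ⟪ g s zero ◂ b₀ , w s′ j ⟫             ∎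
      where open ≡-Reasoning
    ... | no ¬b₀a = begin
      ⟪ g s zero ◂ b₀ ◂ a , w s′ j ⟫                 ≡⟨ ⟪⟫-cong (◂-∙ (g s zero) b₀ a) (λ _ → refl) ⟩
      ⟪ g s zero ◂ (b₀ ∙ a) , w s′ j ⟫   ≡⟨ proj₁ (same (g s zero ◂ (b₀ ∙ a))) (inactive
        (least (b₀ ∙ a) (∙-⊑ˡ b₀ a , λ p → ¬b₀a (⊆-principal⁺ (⊑-trans p (∙-⊑ʳ b₀ a)))))) j ⟩
      + 0                                ∎
      where open ≡-Reasoning


  -- The span of the vectors of s is that of the vectors of rest plus ℤv, and b₀ gives the
  -- character by which B acts on the quotient of the former by the latter.
  record Descent {r} (s : State (suc r)) : Set where
    field
      rest   : State r
      v φ    : Fin n → ℤ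
      b₀     : Fin n
      weaken : ∀ h → Ann (w s) h → Ann (w rest) h
      v-supp : ∀ x → principal x ≢ Y → v x ≡ + 0
      v-ann  : ∀ h → Ann (w s) h → ⟪ h , v ⟫ ≡ + 0
      φ-ann  : Ann (w rest) φ
      φ-v    : ⟪ φ , v ⟫ ≡ + 1
      remove : ∀ h → Ann (w rest) h → Ann (w s) (λ z → h z ℤ.- ⟪ h , v ⟫ ℤ.* φ z)
      v-act  : ∀ h → Ann (w rest) h → ∀ b → ⟪ h ◂ b , v ⟫ ≡ χ′ b₀ b ℤ.* ⟪ h , v ⟫

  descend : Connected → ∀ {r} (s : State (suc r)) → Descent s
  descend connected s with Step.some-active connected s
  ... | b , b-active with Step.minimal-active connected s b (⊏-wellFounded b) b-active
  ...   | b₀ , b₀-active , least with align s (g s zero ◂ b₀) b₀-active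
  ...     | s′ , same , d≢0 , f-row = record
    { rest   = P.rest
    ; v      = w s′ zero
    ; φ      = g s′ zero
    ; b₀     = b₀
    ; weaken = λ h p → proj₁ (same h) p ∘ suc
    ; v-supp = supp s′ zero
    ; v-ann  = λ h p → proj₁ (same h) p zero
    ; φ-ann  = λ j → off s′ λ ()
    ; φ-v    = diag s′ zero
    ; remove = λ h p → proj₂ (same (λ z → h z ℤ.- ⟪ h , w s′ zero ⟫ ℤ.* g s′ zero z)) (P.remove-head h p)
    ; v-act  = P.head-act
    }
    where
    module P = Split s′ b₀ (g s zero ◂ b₀) d≢0 f-row (Step.row-eigen connected s b₀ least s′ same)

  ⟪⟫-δ : ∀ h a → ⟪ h , δ a ⟫ ≡ h a
  ⟪⟫-δ h a = trans
    (sum-single a (λ x x≢a → trans (cong (h x ℤ.*_) (δ-≢ x≢a)) (ℤ.*-zeroʳ (h x))))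
    (trans (cong (h a ℤ.*_) (δ-refl a)) (ℤ.*-identityʳ (h a)))

  L : List (Fin n)
  L = filter (λ x → principal x ≟S Y) (allFin n)

  L-unique : Unique L
  L-unique = filter⁺ (λ x → principal x ≟S Y) (allFin⁺ n)

  L-index : ∀ x → principal x ≡ Y → ∃ λ j → lookup L j ≡ x
  L-index x xY = let x∈L = ∈-filter⁺ (λ x → principal x ≟S Y) (∈-allFin x) xY
                 in index x∈L , sym (lookup-index x∈L)

  L-member : ∀ j → principal (lookup L j) ≡ Y
  L-member j = proj₂ (∈-filter⁻ (λ x → principal x ≟S Y) {xs = allFin n} (∈-lookup {xs = L} j))

  initial-ann : ∀ h → Ann (λ j → δ (lookup L j)) h → ∀ x → principal x ≡ Y → h x ≡ + 0
  initial-ann h p x xY with L-index x xY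
  ... | j , refl = trans (sym (⟪⟫-δ h (lookup L j))) (p j)

  initial : State (length L)
  initial = record
    { g      = λ j → δ (lookup L j)
    ; w      = λ j → δ (lookup L j)
    ; diag   = λ j → trans (⟪⟫-δ (δ (lookup L j)) (lookup L j)) (δ-refl (lookup L j))
    ; off    = λ {i} {j} i≢j → trans (⟪⟫-δ (δ (lookup L i)) (lookup L j))
                                     (δ-≢ (λ eq → i≢j (sym (lookup-injective L-unique {j} {i} eq))))
    ; supp   = λ j x x∉ → δ-≢ {lookup L j} {x} λ { refl → x∉ (L-member j) }
    ; closed = λ h p b j → trans (⟪⟫-δ (h ◂ b) (lookup L j)) (vanish h p b (lookup L j))
    }
    where
    vanish : ∀ h → Ann (λ j → δ (lookup L j)) h → ∀ b x → (h ◂ b) x ≡ + 0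
    vanish h p b x with Y ⊆? principal b
    ... | no _ = refl
    ... | yes Yb with principal x ≟S Y
    ...   | no _   = refl
    ...   | yes xY = initial-ann h p (b ∙ x) (L-∙⁺ Yb xY)

-- Base change to 𝕜 and the composition series.

module ModuleTheory {n : ℕ} (B : LRB n) (y : Fin n) {c ℓ : Level} (K : Field c ℓ) where
  open LRB B
  open LRBNotions B
  open Modules K
  open Support B
  open IntegralFlags B y
  open Field K hiding (zero)
  open FiniteSums commutativeRing
  open FromIntegers commutativeRing
  open import Relation.Binary.Reasoning.Setoid setoid
  open import Algebra.Properties.Ring ring using (-0#≈0#)

  sumK≡sum : ∀ {m} (f : Fin m → Carrier) → sumK f ≡ sum f
  sumK≡sum {zero}  f = ≡.refl
  sumK≡sum {suc m} f = ≡.cong (λ t → f zero + t) (sumK≡sum (f ∘ suc))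

  ι⟨_,_⟩ : (Fin n → ℤ) → V → Carrier
  ι⟨ f , v ⟩ = ⟪ ι ∘ f , v ⟫

  ι⟨⟩-congˡ : ∀ {f g} v → (∀ x → f x ≡ g x) → ι⟨ f , v ⟩ ≈ ι⟨ g , v ⟩
  ι⟨⟩-congˡ v p = ⟪⟫-cong (λ x → reflexive (≡.cong ι (p x))) (λ _ → refl)

  ι⟨⟩-∸ˡ : ∀ f a g v → ι⟨ (λ z → f z ℤ.- a ℤ.* g z) , v ⟩ ≈ ι⟨ f , v ⟩ - ι a * ι⟨ g , v ⟩
  ι⟨⟩-∸ˡ f a g v = trans
    (⟪⟫-cong (λ x → trans (ι-+ (f x) (ℤ.- (a ℤ.* g x)))
       (+-congˡ (trans (ι-neg (a ℤ.* g x)) (-‿cong (ι-* a (g x)))))) (λ _ → refl))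
    (⟪⟫-∸ˡ (ι ∘ f) (ι a) (ι ∘ g) v)

  ι⟨⟩-∸ʳ : ∀ f u a v → ι⟨ f , u -V (a ·V v) ⟩ ≈ ι⟨ f , u ⟩ - a * ι⟨ f , v ⟩
  ι⟨⟩-∸ʳ f u a v = ⟪⟫-∸ʳ (ι ∘ f) u a v

  ι⟨⟩-δ : ∀ x v → ι⟨ δ x , v ⟩ ≈ v x
  ι⟨⟩-δ x v = trans
    (sum-single x (λ z z≢x → trans (*-congʳ (reflexive (≡.cong ι (δ-≢ z≢x)))) (zeroˡ (v z))))
    (trans (*-congʳ (trans (reflexive (≡.cong ι (δ-refl x))) ι-1)) (*-identityˡ (v x)))

  ι⟨⟩-act : ∀ f b v → ι⟨ f , act Y b v ⟩ ≈ ι⟨ f ◂ b , v ⟩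
  ι⟨⟩-act f b v with Y ⊆? principal b
  ... | no _ = trans (sum-zero (λ x → zeroʳ (ι (f x)))) (sym (sum-zero (λ x → zeroˡ (v x))))
  ... | yes _ = begin
    sum (λ x → ι (f x) * sumK (entry x))
      ≈⟨ sum-cong-≋ (λ x → trans (*-congˡ (reflexive (sumK≡sum (entry x)))) (*-distribˡ-sum (ι (f x)) (entry x))) ⟩
    sum (λ x → sum (λ a → ι (f x) * entry x a))
      ≈⟨ ∑-comm (λ x a → ι (f x) * entry x a) ⟩
    sum (λ a → sum (λ x → ι (f x) * entry x a))
      ≈⟨ sum-cong-≋ (λ a → trans (sum-single (b ∙ a) (away a)) (at a)) ⟩
    sum (λ a → ι (cut (λ z → f (b ∙ z)) a) * v a) ∎
    where
    entry : Fin n → Fin n → Carrier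
    entry x a = if does ((b ∙ a ≟ x) ×-dec (principal a ≟S Y)) then v a else 0#
    away : ∀ a x → x ≢ b ∙ a → ι (f x) * entry x a ≈ 0#
    away a x x≢ba rewrite dec-false (b ∙ a ≟ x) (x≢ba ∘ ≡.sym) = zeroʳ (ι (f x))
    at : ∀ a → ι (f (b ∙ a)) * entry (b ∙ a) a ≈ ι (cut (λ z → f (b ∙ z)) a) * v a
    at a rewrite dec-true (b ∙ a ≟ b ∙ a) ≡.refl with does (principal a ≟S Y)
    ... | true  = refl
    ... | false = trans (zeroʳ (ι (f (b ∙ a)))) (sym (zeroˡ (v a)))

  -- The conditional sum in `act` becomes a pairing with an integral row, so that linearity and
  -- idempotence of the action are inherited from `_◂_`.
  act-entry : ∀ b v x → act Y b v x ≈ ι⟨ δ x ◂ b , v ⟩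
  act-entry b v x = trans (sym (ι⟨⟩-δ x (act Y b v))) (ι⟨⟩-act (δ x) b v)

  act-cong : ∀ b {u v} → u ≈V v → act Y b u ≈V act Y b v
  act-cong b {u} {v} p x = trans (act-entry b u x)
    (trans (⟪⟫-cong (λ _ → refl) p) (sym (act-entry b v x)))

  act-∸ : ∀ b u a v → act Y b (u -V (a ·V v)) ≈V (act Y b u -V (a ·V act Y b v))
  act-∸ b u a v x = trans (act-entry b (u -V (a ·V v)) x) (trans (ι⟨⟩-∸ʳ (δ x ◂ b) u a v)
    (sym (+-cong (act-entry b u x) (-‿cong (*-congˡ (act-entry b v x))))))

  act-idem : ∀ b v → act Y b (act Y b v) ≈V act Y b v
  act-idem b v x = begin
    act Y b (act Y b v) x         ≈⟨ act-entry b (act Y b v) x ⟩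
    ι⟨ δ x ◂ b , act Y b v ⟩      ≈⟨ ι⟨⟩-act (δ x ◂ b) b v ⟩
    ι⟨ δ x ◂ b ◂ b , v ⟩          ≈⟨ ι⟨⟩-congˡ v (◂-∙ (δ x) b b) ⟩
    ι⟨ δ x ◂ (b ∙ b) , v ⟩        ≡⟨ ≡.cong (λ d → ι⟨ δ x ◂ d , v ⟩) (idem b) ⟩
    ι⟨ δ x ◂ b , v ⟩              ≈⟨ act-entry b v x ⟨
    act Y b v x                   ∎

  ◂-off-L : ∀ b {x} z → principal x ≢ Y → (δ x ◂ b) z ≡ + 0
  ◂-off-L b {x} z x∉ with Y ⊆? principal b
  ... | no _ = ≡.refl
  ... | yes Yb with principal z ≟S Y
  ...   | no _ = ≡.refl
  ...   | yes zY = δ-≢ {x} {b ∙ z} (λ bz≡x → x∉ (≡.trans (≡.cong principal (≡.sym bz≡x)) (L-∙⁺ Yb zY)))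

  act-InKL : ∀ b v → InKL Y (act Y b v)
  act-InKL b v x x∉ = trans (act-entry b v x)
    (sum-zero (λ z → trans (*-congʳ (reflexive (≡.cong ι (◂-off-L b z x∉)))) (zeroˡ (v z))))

  -- The base change of the summand, given by equations. Because the summand has a complement, these
  -- equations cut out the 𝕜-span of the vectors `w s j`, in every characteristic.
  toSubmodule : ∀ {r} → State r → Submodule Y
  toSubmodule s = record
    { _∋_  = λ u → Lift c (InKL Y u × (∀ h → Ann (w s) h → ι⟨ h , u ⟩ ≈ 0#))
    ; resp = λ p (lift (k , a)) → lift ((λ x x∉ → trans (sym (p x)) (k x x∉)) ,
               λ h q → trans (⟪⟫-cong (λ _ → refl) (λ x → sym (p x))) (a h q))
    ; ∋0   = lift ((λ _ _ → refl) , λ h _ → sum-zero (λ x → zeroʳ (ι (h x))))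
    ; ∋+   = λ {u} {v} (lift (k , a)) (lift (k′ , a′)) → lift
               ( (λ x x∉ → trans (+-cong (k x x∉) (k′ x x∉)) (+-identityˡ 0#))
               , λ h q → trans (⟪⟫-+ʳ (ι ∘ h) u v) (trans (+-cong (a h q) (a′ h q)) (+-identityˡ 0#)) )
    ; ∋·   = λ t {v} (lift (k , a)) → lift
               ( (λ x x∉ → trans (*-congˡ (k x x∉)) (zeroʳ t))
               , λ h q → trans (⟪⟫-*ʳ t (ι ∘ h) v) (trans (*-congˡ (a h q)) (zeroʳ t)) )
    ; ∋act = λ b {v} (lift (k , a)) → lift
               (act-InKL b v , λ h q → trans (ι⟨⟩-act h b v) (a (h ◂ b) (closed s h q b)))
    ; ⊆KL  = λ (lift (k , _)) → k
    }

  x-0≈x : ∀ {x z} → z ≈ 0# → x - z ≈ x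
  x-0≈x z≈0 = trans (+-congˡ (trans (-‿cong z≈0) -0#≈0#)) (+-identityʳ _)

  ι-χ′ : ∀ b₀ b → ι (χ′ b₀ b) ≈ χ (principal b₀) b
  ι-χ′ b₀ b with does (principal b₀ ⊆? principal b)
  ... | true  = ι-1
  ... | false = refl

  module _ {r} {s : State (suc r)} (D : Descent s) where
    open Descent D

    weaken-∋ : ∀ u → toSubmodule rest ∋ u → toSubmodule s ∋ u
    weaken-∋ u (lift (k , a)) = lift (k , λ h q → a h (weaken h q))

    descent-factor : FactorIso (toSubmodule rest) (toSubmodule s) (principal b₀)
    descent-factor = v̂ , v̂-∋ , v̂-∌ , spans , eigenvector
      where
      v̂ : V
      v̂ = ι ∘ v

      pair-v̂ : ∀ h → ι⟨ h , v̂ ⟩ ≈ ι (ℤΣ.⟪ h , v ⟫)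
      pair-v̂ h = sym (ι-⟪⟫ h v)

      v̂-InKL : InKL Y v̂
      v̂-InKL x x∉ = reflexive (≡.cong ι (v-supp x x∉))

      v̂-∋ : toSubmodule s ∋ v̂
      v̂-∋ = lift (v̂-InKL , λ h q → trans (pair-v̂ h) (reflexive (≡.cong ι (v-ann h q))))

      v̂-∌ : ¬ toSubmodule rest ∋ v̂
      v̂-∌ (lift (_ , a)) = 1≉0 (begin
        1#                    ≈⟨ ι-1 ⟨
        ι (+ 1)               ≡⟨ ≡.cong ι φ-v ⟨
        ι (ℤΣ.⟪ φ , v ⟫)  ≈⟨ pair-v̂ φ ⟨
        ι⟨ φ , v̂ ⟩            ≈⟨ a φ φ-ann ⟩
        0#                    ∎)

      spans : ∀ u → toSubmodule s ∋ u → ∃ λ t → toSubmodule rest ∋ (u -V (t ·V v̂))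
      spans u (lift (k , a)) = t , lift
        ( (λ x x∉ → trans (x-0≈x (trans (*-congˡ (v̂-InKL x x∉)) (zeroʳ t))) (k x x∉)) , killed )
        where
        -- The coordinate of u along v̂: φ is 1 on v and vanishes on the smaller submodule.
        t : Carrier
        t = ι⟨ φ , u ⟩
        killed : ∀ h → Ann (w rest) h → ι⟨ h , u -V (t ·V v̂) ⟩ ≈ 0#
        killed h q = begin
          ι⟨ h , u -V (t ·V v̂) ⟩                       ≈⟨ ι⟨⟩-∸ʳ h u t v̂ ⟩
          ι⟨ h , u ⟩ - t * ι⟨ h , v̂ ⟩                  ≈⟨ +-congˡ (-‿cong (trans (*-congˡ (pair-v̂ h)) (*-comm t _))) ⟩
          ι⟨ h , u ⟩ - ι (ℤΣ.⟪ h , v ⟫) * t         ≈⟨ ι⟨⟩-∸ˡ h ℤΣ.⟪ h , v ⟫ φ u ⟨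
          ι⟨ (λ z → h z ℤ.- ℤΣ.⟪ h , v ⟫ ℤ.* φ z) , u ⟩ ≈⟨ a (λ z → h z ℤ.- ℤΣ.⟪ h , v ⟫ ℤ.* φ z) (remove h q) ⟩
          0#                                           ∎

      eigenvector : ∀ b → toSubmodule rest ∋ (act Y b v̂ -V (χ (principal b₀) b ·V v̂))
      eigenvector b = lift
        ( (λ x x∉ → trans (x-0≈x (trans (*-congˡ (v̂-InKL x x∉)) (zeroʳ _))) (act-InKL b v̂ x x∉))
        , λ h q → begin
            ι⟨ h , act Y b v̂ -V (χ (principal b₀) b ·V v̂) ⟩
              ≈⟨ ι⟨⟩-∸ʳ h (act Y b v̂) (χ (principal b₀) b) v̂ ⟩
            ι⟨ h , act Y b v̂ ⟩ - χ (principal b₀) b * ι⟨ h , v̂ ⟩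
              ≈⟨ +-congʳ (trans (ι⟨⟩-act h b v̂) (pair-v̂ (h ◂ b))) ⟩
            ι (ℤΣ.⟪ h ◂ b , v ⟫) - χ (principal b₀) b * ι⟨ h , v̂ ⟩
              ≡⟨ ≡.cong (λ i → ι i - χ (principal b₀) b * ι⟨ h , v̂ ⟩) (v-act h q b) ⟩
            ι (χ′ b₀ b ℤ.* ℤΣ.⟪ h , v ⟫) - χ (principal b₀) b * ι⟨ h , v̂ ⟩
              ≈⟨ +-congʳ (trans (ι-* (χ′ b₀ b) _) (*-cong (ι-χ′ b₀ b) (sym (pair-v̂ h)))) ⟩
            χ (principal b₀) b * ι⟨ h , v̂ ⟩ - χ (principal b₀) b * ι⟨ h , v̂ ⟩
              ≈⟨ -‿inverseʳ _ ⟩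
            0# ∎ )

  -- The descent starts from 𝕜L_Y, whereas a composition series is indexed from 0 upwards; this is
  -- the part already built, to which new factors are attached at the lower end.
  record UpperSeries (U : Submodule Y) : Set (Level.suc (c ⊔ ℓ)) where
    field
      len     : ℕ
      W       : Fin (suc len) → Submodule Y
      label   : Fin len → Subset n
      bottom  : W zero ≡ U
      top     : ∀ v → InKL Y v → W (fromℕ len) ∋ v
      mono    : ∀ i v → W (inject₁ i) ∋ v → W (suc i) ∋ v
      labelΛ  : ∀ i → InΛ (label i)
      factor  : ∀ i → FactorIso (W (inject₁ i)) (W (suc i)) (label i)

  extend : ∀ {r} {s : State (suc r)} (D : Descent s) →
           UpperSeries (toSubmodule s) → UpperSeries (toSubmodule (Descent.rest D))
  extend {s = s} D S = record
    { len    = suc len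
    ; W      = W′
    ; label  = label′
    ; bottom = ≡.refl
    ; top    = top
    ; mono   = mono′
    ; labelΛ = labelΛ′
    ; factor = factor′
    }
    where
    open UpperSeries S
    open Descent D using (b₀; rest)
    W′ : Fin (suc (suc len)) → Submodule Y
    W′ zero    = toSubmodule rest
    W′ (suc i) = W i
    label′ : Fin (suc len) → Subset n
    label′ zero    = principal b₀
    label′ (suc i) = label i
    mono′ : ∀ i v → W′ (inject₁ i) ∋ v → W′ (suc i) ∋ v
    mono′ zero    v p = ≡.subst (_∋ v) (≡.sym bottom) (weaken-∋ D v p)
    mono′ (suc i) v p = mono i v p
    labelΛ′ : ∀ i → InΛ (label′ i)
    labelΛ′ zero    = b₀ , ≡.refl
    labelΛ′ (suc i) = labelΛ i
    factor′ : ∀ i → FactorIso (W′ (inject₁ i)) (W′ (suc i)) (label′ i)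
    factor′ zero    = ≡.subst (λ U → FactorIso (toSubmodule rest) U (principal b₀)) (≡.sym bottom)
                              (descent-factor D)
    factor′ (suc i) = factor i

  complete : Connected → ∀ {r} (s : State r) → UpperSeries (toSubmodule s) → CompositionSeries Y
  complete connected {suc r} s S =
    let D = descend connected s in complete connected (Descent.rest D) (extend D S)
  complete connected {zero}  s S = record
    { UpperSeries S
    -- The family is empty, so every functional annihilates it; the coordinate functional `δ x` then
    -- gives that v vanishes at x.
    ; bottom = λ v p x → trans (sym (ι⟨⟩-δ x v))
        (proj₂ (lower (≡.subst (_∋ v) (UpperSeries.bottom S) p)) (δ x) (λ ()))
    }

  compositionSeries : Connected → CompositionSeries Y
  compositionSeries connected = complete connected initial (record
    { len    = 0
    ; W      = λ _ → toSubmodule initial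
    ; label  = λ ()
    ; bottom = ≡.refl
    ; top    = λ v k → lift (k , λ h q → sum-zero (term v k h q))
    ; mono   = λ ()
    ; labelΛ = λ ()
    ; factor = λ ()
    })
    where
    term : ∀ v → InKL Y v → ∀ h → Ann (w initial) h → ∀ x → ι (h x) * v x ≈ 0#
    term v k h q x with principal x ≟S Y
    ... | yes xY = trans (*-congʳ (reflexive (≡.cong ι (initial-ann h q x xY)))) (zeroˡ (v x))
    ... | no x∉  = trans (*-congˡ (k x x∉)) (zeroʳ (ι (h x)))

-- Dimension counts over a field without decidable equality.

-- Allows the proof of a negated statement to assume, for finitely many coefficients at once, what
-- is known of each only up to double negation.
¬¬-all : ∀ {p m} {P : Fin m → Set p} → (∀ i → ¬ ¬ P i) → ¬ ¬ (∀ i → P i)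
¬¬-all {m = zero}  h k = k λ ()
¬¬-all {m = suc m} h k = h zero λ p₀ → ¬¬-all (h ∘ suc) λ p → k λ { zero → p₀ ; (suc i) → p i }

module VectorSpaceFlags {c ℓ : Level} (K : Field c ℓ) (n : ℕ) where
  open Field K hiding (zero)
  open FiniteSums commutativeRing
  open FromIntegers commutativeRing using (solve; _:=_; _:+_; _:*_; :-_; _:-_; con)
  open import Relation.Binary.Reasoning.Setoid setoid
  open import Algebra.Properties.Ring ring using (-0#≈0#)

  private
    V : Set c
    V = Fin n → Carrier

    Pred : Set _
    Pred = V → Set (c ⊔ ℓ)

  record IsSubspace (D : Pred) : Set (c ⊔ ℓ) where
    field
      resp  : ∀ {u v} → (∀ x → u x ≈ v x) → D u → D v
      zero∈ : D (λ _ → 0#)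
      minus : ∀ {u v} a → D u → D v → D (λ x → u x - a * v x)

  -- A space of dimension k, presented by steps of the same shape as `FactorIso`, so that a
  -- composition series can produce them one by one.
  data Flag : Pred → ℕ → Set (Level.suc (c ⊔ ℓ)) where
    nil  : ∀ {D} → (∀ u → D u → ∀ x → u x ≈ 0#) → Flag D 0
    cons : ∀ {U D k} t → Flag U k → IsSubspace U → (∀ u → U u → D u) → D t → ¬ U t →
           (∀ u → D u → ∃ λ a → U (λ x → u x - a * t x)) → Flag D (suc k)

  Flag-resp : ∀ {D E k} → (∀ u → D u → E u) → (∀ u → E u → D u) → Flag D k → Flag E k
  Flag-resp f g (nil z) = nil λ u p → z u (g u p)
  Flag-resp f g (cons t F S incl t∈ t∉ span) =
    cons t F S (λ u p → f u (incl u p)) (f t t∈) t∉ (λ u p → span u (g u p))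

  combination : ∀ {D m} → IsSubspace D → (a : Fin m → Carrier) (t : Fin m → V) → (∀ i → D (t i)) →
                D (λ x → sum (λ i → a i * t i x))
  combination {m = zero}  S a t t∈ = IsSubspace.zero∈ S
  combination {m = suc m} S a t t∈ = resp
    (λ x → solve 3 (λ s a t → s :- (:- a) :* t := a :* t :+ s) refl
             (sum (λ i → a (suc i) * t (suc i) x)) (a zero) (t zero x))
    (minus (- a zero) (combination S (a ∘ suc) (t ∘ suc) (t∈ ∘ suc)) (t∈ zero))
    where open IsSubspace S

  -- The double negation is the price of undecidable equality; it suffices to contradict
  -- `Dependent`.
  Independent : ∀ {m} → (Fin m → V) → Set (c ⊔ ℓ)
  Independent {m} t = ∀ (a : Fin m → Carrier) → (∀ x → sum (λ i → a i * t i x) ≈ 0#) → ∀ i → ¬ ¬ a i ≈ 0#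

  Dependent : ∀ {m} → (Fin m → V) → Set (c ⊔ ℓ)
  Dependent {m} t = ∃ λ (a : Fin m → Carrier) → (∃ λ i → ¬ a i ≈ 0#) × (∀ x → sum (λ i → a i * t i x) ≈ 0#)

  independent-family : ∀ {D k} → Flag D k → ∀ {m} → m ℕ.≤ k →
                       ∃ λ (t : Fin m → V) → (∀ i → D (t i)) × Independent t
  independent-family F z≤n = (λ ()) , (λ ()) , λ _ _ ()
  independent-family (cons {U} {D} t₀ F S incl t₀∈ t₀∉ span) {suc m} (s≤s m≤k)
    with independent-family F m≤k
  ... | t , t∈ , indep = t′ , t′∈ , indep′
    where
    open IsSubspace S
    t′ : Fin (suc m) → V
    t′ zero    = t₀
    t′ (suc i) = t i
    t′∈ : ∀ i → D (t′ i)
    t′∈ zero    = t₀∈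
    t′∈ (suc i) = incl (t i) (t∈ i)
    -- A nonzero coefficient of t₀ would be invertible, and solving the relation for t₀ would place
    -- it in U.
    head-zero : ∀ (a : Fin (suc m) → Carrier) → (∀ x → sum (λ i → a i * t′ i x) ≈ 0#) → ¬ ¬ a zero ≈ 0#
    head-zero a e a₀≉0 with inverse (a zero) a₀≉0
    ... | z , a₀z≈1 = t₀∉ (resp eq (minus z zero∈ (combination S (a ∘ suc) t t∈)))
      where
      eq : ∀ x → 0# - z * sum (λ i → a (suc i) * t i x) ≈ t₀ x
      eq x = begin
        0# - z * s                            ≈⟨ solve 4 (λ z s a t → con (+ 0) :- z :* s :=
                                                   (a :* z) :* t :- z :* (a :* t :+ s)) refl z s (a zero) (t₀ x) ⟩
        (a zero * z) * t₀ x - z * (a zero * t₀ x + s) ≈⟨ +-cong (*-congʳ a₀z≈1) (-‿cong (*-congˡ (e x))) ⟩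
        1# * t₀ x - z * 0#                    ≈⟨ +-cong (*-identityˡ _) (-‿cong (zeroʳ z)) ⟩
        t₀ x - 0#                             ≈⟨ +-congˡ -0#≈0# ⟩
        t₀ x + 0#                             ≈⟨ +-identityʳ _ ⟩
        t₀ x                                  ∎
        where s = sum (λ i → a (suc i) * t i x)
    indep′ : Independent t′
    indep′ a e zero    = head-zero a e
    indep′ a e (suc i) k = head-zero a e λ a₀≈0 → indep (a ∘ suc)
      (λ x → trans (sym (trans (+-congʳ (trans (*-congʳ a₀≈0) (zeroˡ _))) (+-identityˡ _))) (e x)) i k

  -- Gaussian elimination with pivot `u j`, where z is to be the inverse of `a j`; a relation among
  -- the reduced vectors determines the coefficient `bⱼ` of the pivot.
  module Pivot {m : ℕ} (u : Fin (suc m) → V) (a : Fin (suc m) → Carrier) (j : Fin (suc m)) (z : Carrier) where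
    ratio : Fin m → Carrier
    ratio i = a (punchIn j i) * z

    reduced : Fin m → V
    reduced i x = u (punchIn j i) x - ratio i * u j x

    lift-dependence : Dependent reduced → Dependent u
    lift-dependence (b , (l , b≉0) , e) = b′ , (punchIn j l , λ p → b≉0 (trans (sym (b′-punchIn l)) p)) , e′
      where
      bⱼ : Carrier
      bⱼ = - sum (λ i → b i * ratio i)
      b′ : Fin (suc m) → Carrier
      b′ = insertAt b j bⱼ
      b′-punchIn : ∀ i → b′ (punchIn j i) ≈ b i
      b′-punchIn i = reflexive (insertAt-punchIn b j bⱼ i)
      e′ : ∀ x → sum (λ i → b′ i * u i x) ≈ 0#
      e′ x = begin
        sum (λ i → b′ i * u i x)
          ≈⟨ sum-remove {i = j} (λ i → b′ i * u i x) ⟩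
        b′ j * u j x + sum (λ i → b′ (punchIn j i) * u (punchIn j i) x)
          ≈⟨ +-cong (*-congʳ (reflexive (insertAt-lookup b j bⱼ))) (sum-cong-≋ (λ i → *-congʳ (b′-punchIn i))) ⟩
        bⱼ * u j x + ⟪ b , (λ i → u (punchIn j i) x) ⟫
          ≈⟨ solve 3 (λ s t p → (:- s) :* t :+ p := p :- t :* s) refl
               ⟪ b , ratio ⟫ (u j x) ⟪ b , (λ i → u (punchIn j i) x) ⟫ ⟩
        ⟪ b , (λ i → u (punchIn j i) x) ⟫ - u j x * ⟪ b , ratio ⟫
          ≈⟨ ⟪⟫-∸ʳ b (λ i → u (punchIn j i) x) (u j x) ratio ⟨
        ⟪ b , (λ i → u (punchIn j i) x - u j x * ratio i) ⟫
          ≈⟨ ⟪⟫-cong (λ _ → refl) (λ i → +-congˡ (-‿cong (*-comm (u j x) (ratio i)))) ⟩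
        ⟪ b , (λ i → reduced i x) ⟫
          ≈⟨ e x ⟩
        0# ∎

  -- If some coefficient along t is nonzero, elimination moves the other vectors into U; if none is,
  -- all vectors lie in U modulo zero multiples of t, and one is dropped. Either way the flag of U,
  -- one step shorter, applies.
  dependent-family : ∀ {D k} → Flag D k → (u : Fin (suc k) → V) → (∀ i → D (u i)) → ¬ ¬ Dependent u
  dependent-family (nil z) u u∈ k = k ((λ _ → 1#) , (zero , 1≉0) , λ x →
    trans (+-identityʳ _) (trans (*-congˡ (z (u zero) (u∈ zero) x)) (zeroʳ 1#)))
  dependent-family {k = suc k} (cons {U} t F S incl t∈ t∉ span) u u∈ ¬dep =
    ¬¬-all (λ j aⱼ≉0 → pivot j aⱼ≉0) λ all-zero →
      dependent-family F (u ∘ suc) (λ i → resp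
          (λ x → trans (+-congˡ (trans (-‿cong (trans (*-congʳ (all-zero (suc i))) (zeroˡ _))) -0#≈0#))
                       (+-identityʳ _))
          (proj₂ (span (u (suc i)) (u∈ (suc i)))))
        λ (b , (l , b≉0) , e) → ¬dep
          ( (λ { zero → 0# ; (suc i) → b i }) , (suc l , b≉0)
          , λ x → trans (+-cong (zeroˡ _) (e x)) (+-identityˡ 0#) )
    where
    open IsSubspace S
    a : Fin (suc (suc k)) → Carrier
    a j = proj₁ (span (u j) (u∈ j))
    pivot : ∀ j → ¬ ¬ a j ≈ 0#
    pivot j aⱼ≉0 with inverse (a j) aⱼ≉0
    ... | z , aⱼz≈1 = dependent-family F reduced reduced∈ (¬dep ∘ lift-dependence)
      where
      open Pivot u a j z
      reduced∈ : ∀ i → U (reduced i)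
      reduced∈ i = resp eq (minus (ratio i) (proj₂ (span (u (punchIn j i)) (u∈ (punchIn j i))))
                                            (proj₂ (span (u j) (u∈ j))))
        where
        aᵢ : Carrier
        aᵢ = a (punchIn j i)
        eq : ∀ x → (u (punchIn j i) x - aᵢ * t x) - ratio i * (u j x - a j * t x) ≈ reduced i x
        eq x = begin
          (u (punchIn j i) x - aᵢ * t x) - aᵢ * z * (u j x - a j * t x)
            ≈⟨ solve 5 (λ p q r s s′ → (p :- s) :- r :* (q :- s′) := (p :- r :* q) :+ (r :* s′ :- s)) refl
                 (u (punchIn j i) x) (u j x) (ratio i) (aᵢ * t x) (a j * t x) ⟩
          reduced i x + (ratio i * (a j * t x) - aᵢ * t x)
            ≈⟨ +-congˡ (+-congʳ (solve 4 (λ aᵢ z aⱼ t → aᵢ :* z :* (aⱼ :* t) := aᵢ :* t :* (aⱼ :* z)) refl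
                 aᵢ z (a j) (t x))) ⟩
          reduced i x + (aᵢ * t x * (a j * z) - aᵢ * t x)
            ≈⟨ +-congˡ (+-congʳ (trans (*-congˡ aⱼz≈1) (*-identityʳ _))) ⟩
          reduced i x + (aᵢ * t x - aᵢ * t x)
            ≈⟨ +-congˡ (-‿inverseʳ _) ⟩
          reduced i x + 0#
            ≈⟨ +-identityʳ _ ⟩
          reduced i x ∎

  -- Too long an independent family would be dependent. The double negations disappear because `ℕ.≤`
  -- is decidable.
  Flag-≤ : ∀ {D E k l} → (∀ u → D u → E u) → Flag D k → Flag E l → k ℕ.≤ l
  Flag-≤ {k = k} {l} incl F G = decidable-stable (k ℕ.≤? l) λ k≰l →
    let t , t∈ , indep = independent-family F (ℕ.≰⇒> k≰l)
    in dependent-family G t (λ i → incl (t i) (t∈ i)) λ (a , (i , a≉0) , e) → indep a e i a≉0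

  SupportedOn : List (Fin n) → Pred
  SupportedOn xs u = Lift c (∀ x → x ∉ xs → u x ≈ 0#)

  SupportedOn-isSubspace : ∀ xs → IsSubspace (SupportedOn xs)
  SupportedOn-isSubspace xs = record
    { resp  = λ e (lift p) → lift λ x x∉ → trans (sym (e x)) (p x x∉)
    ; zero∈ = lift λ _ _ → refl
    ; minus = λ a (lift p) (lift q) → lift λ x x∉ →
        trans (+-cong (p x x∉) (trans (-‿cong (trans (*-congˡ (q x x∉)) (zeroʳ a))) -0#≈0#)) (+-identityˡ 0#)
    }

  SupportedOn-flag : ∀ {xs} → Unique xs → Flag (SupportedOn xs) (length xs)
  SupportedOn-flag []                       = nil λ u (lift p) x → p x λ ()
  SupportedOn-flag {y ∷ xs} (y∉xs ∷ xs!) = cons t (SupportedOn-flag xs!) (SupportedOn-isSubspace xs)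
    (λ u (lift p) → lift λ x x∉ → p x (x∉ ∘ there))
    (lift λ x x∉ → t-≢ x (x∉ ∘ here))
    (λ (lift p) → 1≉0 (trans (sym t-y) (p y (λ y∈ → All.lookup y∉xs y∈ ≡.refl))))
    (λ u (lift p) → u y , lift (residue u p))
    where
    t : V
    t x = if does (x ≟ y) then 1# else 0#
    t-y : t y ≈ 1#
    t-y rewrite dec-true (y ≟ y) ≡.refl = refl
    t-≢ : ∀ x → x ≢ y → t x ≈ 0#
    t-≢ x x≢y rewrite dec-false (x ≟ y) x≢y = refl
    residue : ∀ u → (∀ x → x ∉ y ∷ xs → u x ≈ 0#) → ∀ x → x ∉ xs → u x - u y * t x ≈ 0#
    residue u p x x∉ with x ≟ y
    ... | yes ≡.refl = trans (+-congˡ (-‿cong (*-identityʳ (u y)))) (-‿inverseʳ (u y))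
    ... | no x≢y     = trans (+-cong (p x λ { (here e) → x≢y e ; (there i) → x∉ i })
                                     (trans (-‿cong (zeroʳ (u y))) -0#≈0#)) (+-identityˡ 0#)

-- Counting with Iverson brackets.

⟦_⟧ : ∀ {p} {P : Set p} → Dec P → ℤ
⟦ p ⟧ = if does p then + 1 else + 0

length-filter-tabulate : ∀ {a p m} {A : Set a} {P : A → Set p} (P? : Decidable P) (f : Fin m → A) →
                         + length (filter P? (tabulate f)) ≡ ℤΣ.sum (λ i → ⟦ P? (f i) ⟧)
length-filter-tabulate {m = zero}  P? f = ≡.refl
length-filter-tabulate {m = suc m} P? f with does (P? (f zero))
... | true  = ≡.cong ℤ.suc (length-filter-tabulate P? (f ∘ suc))
... | false = ≡.trans (length-filter-tabulate P? (f ∘ suc)) (≡.sym (ℤ.+-identityˡ _))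

count-sum : ∀ {m p} {P : Fin m → Set p} (P? : ∀ i → Dec (P i)) → + count P? ≡ ℤΣ.sum (λ i → ⟦ P? i ⟧)
count-sum P? = length-filter-tabulate P? (λ i → i)

-- The rank of an element of B on 𝕜L_Y.

module Rank {n : ℕ} (B : LRB n) (y : Fin n) {c ℓ : Level} (K : Field c ℓ) where
  open LRB B
  open LRBNotions B
  open Modules K
  open Support B
  open IntegralFlags B y
  open ModuleTheory B y K
  open VectorSpaceFlags K n
  open Field K hiding (zero)
  open FiniteSums commutativeRing
  open FromIntegers commutativeRing
  open import Relation.Binary.Reasoning.Setoid setoid
  open import Algebra.Properties.Ring ring using (-1*x≈-x)

  Fixed : Submodule Y → Fin n → V → Set (c ⊔ ℓ)
  Fixed U b u = U ∋ u × act Y b u ≈V u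

  ∋-∸ : ∀ (U : Submodule Y) {u v} a → U ∋ u → U ∋ v → U ∋ (u -V (a ·V v))
  ∋-∸ U {u} {v} a p q = resp U
    (λ x → +-congˡ (-1*x≈-x (a * v x)))
    (∋+ U p (∋· U (- 1#) (∋· U a q)))

  Fixed-isSubspace : ∀ U b → IsSubspace (Fixed U b)
  Fixed-isSubspace U b = record
    { resp  = λ {u} {v} e (p , q) → resp U e p ,
        λ x → trans (act-cong b (λ z → sym (e z)) x) (trans (q x) (e x))
    ; zero∈ = ∋0 U , λ x → trans (act-entry b 0V x) (sum-zero {n} (λ z → zeroʳ (ι ((δ x ◂ b) z))))
    ; minus = λ {u} {v} a (p , q) (p′ , q′) → ∋-∸ U a p p′ ,
        λ x → trans (act-∸ b u a v x) (+-cong (q x) (-‿cong (*-congˡ (q′ x))))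
    }

  χ-eigen : ∀ {U W X} ((v , _) : FactorIso {Y} U W X) b → X ⊆ principal b → U ∋ (act Y b v -V v)
  χ-eigen {U} {X = X} (v , _ , _ , _ , eig) b Xb with X ⊆? principal b | eig b
  ... | yes _ | p = resp U (λ x → +-congˡ (-‿cong (*-identityˡ (v x)))) p
  ... | no ¬p | _ = contradiction (λ {x} → Xb {x}) ¬p

  χ-null : ∀ {U W X} ((v , _) : FactorIso {Y} U W X) b → ¬ X ⊆ principal b → U ∋ act Y b v
  χ-null {U} {X = X} (v , _ , _ , _ , eig) b ¬Xb with X ⊆? principal b | eig b
  ... | no _  | p = resp U (λ x → x-0≈x (zeroˡ (v x))) p
  ... | yes q | _ = contradiction (λ {x} → q {x}) ¬Xb

  -- If X ⊆ Bb, then bv is fixed and congruent to v modulo U, so one dimension is gained. Otherwise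
  -- bv lies in U, and a fixed u in W satisfies u = bu ≡ a bv ≡ 0 modulo U, so nothing is gained.
  fixed-step : ∀ (U W : Submodule Y) X → (∀ v → U ∋ v → W ∋ v) → FactorIso U W X → ∀ b {k} →
               Flag (Fixed U b) k → ∃ λ k′ → Flag (Fixed W b) k′ × + k′ ≡ ⟦ X ⊆? principal b ⟧ ℤ.+ + k
  fixed-step U W X incl iso@(v , v∈ , v∉ , spans , _) b {k} F with X ⊆? principal b
  ... | yes Xb = suc k ,
    cons (act Y b v) F (Fixed-isSubspace U b) (λ u (p , q) → incl u p , q)
      (∋act W b v∈ , act-idem b v) (λ (p , _) → v∉ (v∈U p)) span , ≡.refl
    where
    v∈U : U ∋ act Y b v → U ∋ v
    v∈U p = resp U (λ x → trans
        (+-congˡ (-‿cong (*-identityˡ _)))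
        (solve 2 (λ s t → s :- (s :- t) := t) refl (act Y b v x) (v x)))
      (∋-∸ U 1# p (χ-eigen {U} {W} iso b Xb))
    span : ∀ u → Fixed W b u → ∃ λ a → Fixed U b (u -V (a ·V act Y b v))
    span u (p , q) = a , resp U eq (∋act U b (proj₂ (spans u p))) , λ x →
        trans (act-∸ b u a (act Y b v) x) (+-cong (q x) (-‿cong (*-congˡ (act-idem b v x))))
      where
      a : Carrier
      a = proj₁ (spans u p)
      eq : ∀ x → act Y b (u -V (a ·V v)) x ≈ u x - a * act Y b v x
      eq x = trans (act-∸ b u a v x) (+-congʳ (q x))
  ... | no ¬Xb = k ,
    Flag-resp (λ u (p , q) → incl u p , q) (λ u (p , q) → u∈U u p q , q) F ,
    ≡.sym (ℤ.+-identityˡ (+ k))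
    where
    u∈U : ∀ u → W ∋ u → act Y b u ≈V u → U ∋ u
    u∈U u p q = resp U eq (∋-∸ U (- a) (∋act U b (proj₂ (spans u p))) (χ-null {U} {W} iso b ¬Xb))
      where
      a : Carrier
      a = proj₁ (spans u p)
      eq : ∀ x → act Y b (u -V (a ·V v)) x - (- a) * act Y b v x ≈ u x
      eq x = begin
        act Y b (u -V (a ·V v)) x - (- a) * act Y b v x      ≈⟨ +-congʳ (trans (act-∸ b u a v x) (+-congʳ (q x))) ⟩
        u x - a * act Y b v x - (- a) * act Y b v x
          ≈⟨ solve 3 (λ u a t → (u :- a :* t) :- (:- a) :* t := u) refl (u x) a (act Y b v x) ⟩
        u x                                                  ∎

  fixed-chain : ∀ len (W : Fin (suc len) → Submodule Y) (label : Fin len → Subset n) →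
                (∀ i v → W (inject₁ i) ∋ v → W (suc i) ∋ v) →
                (∀ i → FactorIso (W (inject₁ i)) (W (suc i)) (label i)) →
                ∀ b {k} → Flag (Fixed (W zero) b) k →
                ∃ λ k′ → Flag (Fixed (W (fromℕ len)) b) k′ ×
                         + k′ ≡ ℤΣ.sum (λ i → ⟦ label i ⊆? principal b ⟧) ℤ.+ + k
  fixed-chain zero      W label mono factor b {k} F = k , F , ≡.sym (ℤ.+-identityˡ (+ k))
  fixed-chain (suc len) W label mono factor b {k} F
    with fixed-step (W zero) (W (suc zero)) (label zero) (mono zero) (factor zero) b F
  ... | k₁ , F₁ , eq₁ with fixed-chain len (W ∘ suc) (label ∘ suc) (mono ∘ suc) (factor ∘ suc) b F₁
  ...   | k₂ , F₂ , eq₂ = k₂ , F₂ , ≡.trans eq₂ (≡.trans (≡.cong (λ i → s ℤ.+ i) eq₁)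
      (≡.trans (≡.sym (ℤ.+-assoc s x (+ k))) (≡.cong (ℤ._+ + k) (ℤ.+-comm s x))))
    where
    s x : ℤ
    s = ℤΣ.sum (λ i → ⟦ label (suc i) ⊆? principal b ⟧)
    x = ⟦ label zero ⊆? principal b ⟧

  module _ (S : CompositionSeries Y) (b : Fin n) where
    open CompositionSeries S

    bB∩L? : ∀ x → Dec ((∃ λ a → b ∙ a ≡ x) × principal x ≡ Y)
    bB∩L? x = any? (λ a → b ∙ a ≟ x) ×-dec (principal x ≟S Y)

    bB∩L : List (Fin n)
    bB∩L = filter bB∩L? (allFin n)

    ∈⁺ : ∀ {x} → (∃ λ a → b ∙ a ≡ x) → principal x ≡ Y → x ∈ bB∩L
    ∈⁺ {x} p q = ∈-filter⁺ bB∩L? (∈-allFin x) (p , q)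

    ∈⁻ : ∀ {x} → x ∈ bB∩L → (∃ λ a → b ∙ a ≡ x) × principal x ≡ Y
    ∈⁻ x∈ = proj₂ (∈-filter⁻ bB∩L? {xs = allFin n} x∈)

    -- `δ x ◂ b` is row x of the matrix of b on 𝕜L_Y. The image of b has entries only on bB ∩ L_Y,
    -- and b fixes the basis vectors there since b(ba) = ba, so the fixed space is a coordinate
    -- subspace.
    δ◂-outside : ∀ {x} → x ∉ bB∩L → ∀ z → (δ x ◂ b) z ≡ + 0
    δ◂-outside {x} x∉ z with principal x ≟S Y
    ... | no ¬xY = ◂-off-L b z ¬xY
    ... | yes xY with Y ⊆? principal b
    ...   | no _ = ≡.refl
    ...   | yes _ with principal z ≟S Y
    ...     | no _ = ≡.refl
    ...     | yes _ = δ-≢ {x} {b ∙ z} (λ bz≡x → x∉ (∈⁺ (z , bz≡x) xY))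

    δ◂-inside : ∀ x {z} → z ∈ bB∩L → (δ x ◂ b) z ≡ δ x z
    δ◂-inside x {z} z∈ with ∈⁻ z∈
    ... | (a , ≡.refl) , zY
      rewrite dec-true (Y ⊆? principal b) (L-∙⁻ zY) | dec-true (principal (b ∙ a) ≟S Y) zY
            | ≡.sym (assoc b b a) | idem b = ≡.refl

    fixed⇒supported : ∀ u → Fixed (W (fromℕ len)) b u → SupportedOn bB∩L u
    fixed⇒supported u (_ , q) = lift λ x x∉ → trans (sym (q x)) (trans (act-entry b u x)
      (sum-zero λ z → trans (*-congʳ (reflexive (≡.cong ι (δ◂-outside x∉ z)))) (zeroˡ (u z))))

    supported⇒fixed : ∀ u → SupportedOn bB∩L u → Fixed (W (fromℕ len)) b u
    supported⇒fixed u (lift p) = top u (λ x ¬xY → p x (¬xY ∘ proj₂ ∘ ∈⁻)) , λ x → begin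
      act Y b u x          ≈⟨ act-entry b u x ⟩
      ι⟨ δ x ◂ b , u ⟩     ≈⟨ sum-cong-≋ (term x) ⟩
      ι⟨ δ x , u ⟩         ≈⟨ ι⟨⟩-δ x u ⟩
      u x                  ∎
      where
      term : ∀ x z → ι ((δ x ◂ b) z) * u z ≈ ι (δ x z) * u z
      term x z with bB∩L? z
      ... | yes (q , q′) = *-congʳ (reflexive (≡.cong ι (δ◂-inside x (∈⁺ q q′))))
      ... | no ¬q = let uz≈0 = p z (¬q ∘ ∈⁻) in
        trans (trans (*-congˡ uz≈0) (zeroʳ _)) (sym (trans (*-congˡ uz≈0) (zeroʳ _)))

    -- Both sides compute the rank of b on 𝕜L_Y.
    sum-labels : ℤΣ.sum (λ i → ⟦ label i ⊆? principal b ⟧) ≡ + card-eB∩L b Y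
    sum-labels with fixed-chain len W label mono factor b (nil (λ u (p , _) → bottom u p))
    ... | k , F , eq = ≡.trans (≡.sym (≡.trans eq (ℤ.+-identityʳ _))) (≡.cong +_ (ℕ.≤-antisym
            (Flag-≤ fixed⇒supported F G) (Flag-≤ supported⇒fixed G F)))
      where
      G : Flag (SupportedOn bB∩L) (length bB∩L)
      G = SupportedOn-flag (filter⁺ bB∩L? (allFin⁺ n))

-- Möbius inversion on Λ(B).

⟦⟧-yes : ∀ {p} {P : Set p} (P? : Dec P) → P → ⟦ P? ⟧ ≡ + 1
⟦⟧-yes P? p = ≡.cong (λ b → if b then + 1 else + 0) (dec-true P? p)

⟦⟧-no : ∀ {p} {P : Set p} (P? : Dec P) → ¬ P → ⟦ P? ⟧ ≡ + 0
⟦⟧-no P? ¬p = ≡.cong (λ b → if b then + 1 else + 0) (dec-false P? ¬p)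

⟦⟧-zero : ∀ {p} {P : Set p} (P? : Dec P) {i} → (P → i ≡ + 0) → ⟦ P? ⟧ ℤ.* i ≡ + 0
⟦⟧-zero (yes p) h = ≡.cong (λ j → + 1 ℤ.* j) (h p)
⟦⟧-zero (no ¬p) h = ≡.refl

sumℤ-filter : ∀ {a p} {A : Set a} {P : A → Set p} (P? : Decidable P) (f : A → ℤ) xs →
              sumℤ (map f (filter P? xs)) ≡ ℤΣ.sum (λ i → ⟦ P? (lookup xs i) ⟧ ℤ.* f (lookup xs i))
sumℤ-filter P? f []       = ≡.refl
sumℤ-filter P? f (x ∷ xs) with does (P? x)
... | true  = ≡.cong₂ ℤ._+_ (≡.sym (ℤ.*-identityˡ (f x))) (sumℤ-filter P? f xs)
... | false = ≡.trans (sumℤ-filter P? f xs) (≡.sym (ℤ.+-identityˡ _))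

module Inversion {n : ℕ} (B : LRB n) (μ : Subset n → Subset n → ℤ)
                 (mobius : LRBNotions.IsMobius B μ) where
  open ≡ using (refl; sym; trans; cong; cong₂; module ≡-Reasoning)
  open ℤΣ
  open LRBNotions B
  open IsMobius mobius

  m : ℕ
  m = length ΛList

  Λ : Fin m → Subset n
  Λ = lookup ΛList

  Λ-InΛ : ∀ i → InΛ (Λ i)
  Λ-InΛ i with ∈-map⁻ principal (∈-deduplicate⁻ _≟S_ (map principal (allFin n)) (∈-lookup {xs = ΛList} i))
  ... | b , _ , eq = b , sym eq

  Λ-index : ∀ {X} → InΛ X → ∃ λ i → Λ i ≡ X
  Λ-index (b , refl) = let b∈ = ∈-deduplicate⁺ _≟S_ (∈-map⁺ principal (∈-allFin b))
                       in index b∈ , sym (lookup-index b∈)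

  Λ-injective : ∀ {i j} → Λ i ≡ Λ j → i ≡ j
  Λ-injective = lookup-injective (deduplicate-! _≟S_ (map principal (allFin n)))

  _≼_ : Fin m → Fin m → Set
  i ≼ j = Λ i ⊆ Λ j

  _≼?_ : ∀ i j → Dec (i ≼ j)
  i ≼? j = Λ i ⊆? Λ j

  ≼-isPartialOrder : IsPartialOrder _≡_ _≼_
  ≼-isPartialOrder = record
    { isPreorder = record
      { isEquivalence = ≡.isEquivalence
      ; reflexive     = λ { refl → id }
      ; trans         = λ p q → q ∘ p
      }
    ; antisym = λ p q → Λ-injective (⊆-antisym p q)
    }

  -- Since μ vanishes off the order relation, the sum over an interval may run over everything below
  -- j, and the identity extends to i not below j.
  μ-column : ∀ i j → sum (λ k → ⟦ k ≼? j ⟧ ℤ.* μ (Λ i) (Λ k)) ≡ ⟦ Λ i ≟S Λ j ⟧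
  μ-column i j with i ≼? j
  ... | yes i≼j = trans (sum-cong-≗ term) (trans
      (sym (sumℤ-filter (λ W → (Λ i ⊆? W) ×-dec (W ⊆? Λ j)) (μ (Λ i)) ΛList))
      (mobius-sum (Λ i) (Λ j) (Λ-InΛ i) (Λ-InΛ j) (λ {x} → i≼j {x})))
    where
    term : ∀ k → ⟦ k ≼? j ⟧ ℤ.* μ (Λ i) (Λ k) ≡ ⟦ (i ≼? k) ×-dec (k ≼? j) ⟧ ℤ.* μ (Λ i) (Λ k)
    term k with i ≼? k
    ... | yes _    = refl
    ... | no ¬i≼k = trans (cong (⟦ k ≼? j ⟧ ℤ.*_) (mobius-zero (Λ i) (Λ k) (Λ-InΛ i) (Λ-InΛ k) ¬i≼k))
                          (ℤ.*-zeroʳ ⟦ k ≼? j ⟧)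
  ... | no ¬i≼j = trans
    (sum-zero (λ k → ⟦⟧-zero (k ≼? j) λ k≼j →
      mobius-zero (Λ i) (Λ k) (Λ-InΛ i) (Λ-InΛ k) λ i≼k → ¬i≼j (k≼j ∘ i≼k)))
    (sym (⟦⟧-no (Λ i ≟S Λ j) λ eq → ¬i≼j (⊆-reflexive eq)))

  μ-diagonal : ∀ j → μ (Λ j) (Λ j) ≡ + 1
  μ-diagonal j = begin
    μ (Λ j) (Λ j)                    ≡⟨ ℤ.*-identityˡ _ ⟨
    + 1 ℤ.* μ (Λ j) (Λ j)            ≡⟨ cong (ℤ._* μ (Λ j) (Λ j)) (⟦⟧-yes (j ≼? j) id) ⟨
    ⟦ j ≼? j ⟧ ℤ.* μ (Λ j) (Λ j)     ≡⟨ sum-single j (λ k k≢j → ⟦⟧-zero (k ≼? j) λ k≼j →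
        mobius-zero (Λ j) (Λ k) (Λ-InΛ j) (Λ-InΛ k) λ j≼k → k≢j (Λ-injective (⊆-antisym k≼j j≼k))) ⟨
    sum (λ k → ⟦ k ≼? j ⟧ ℤ.* μ (Λ j) (Λ k)) ≡⟨ μ-column j j ⟩
    ⟦ Λ j ≟S Λ j ⟧                   ≡⟨ ⟦⟧-yes (Λ j ≟S Λ j) refl ⟩
    + 1                              ∎
    where open ≡-Reasoning

  -- The zeta matrix is unitriangular: every other term of the sum at j has its index strictly below
  -- j and vanishes by induction.
  lower-sums-determine : ∀ (f : Fin m → ℤ) → (∀ j → sum (λ i → ⟦ i ≼? j ⟧ ℤ.* f i) ≡ + 0) → ∀ j → f j ≡ + 0
  lower-sums-determine f z j = go j (po-wellFounded ≼-isPartialOrder j)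
    where
    go : ∀ j → Acc _ j → f j ≡ + 0
    go j (acc rec) = begin
      f j                            ≡⟨ ℤ.*-identityˡ (f j) ⟨
      + 1 ℤ.* f j                    ≡⟨ cong (ℤ._* f j) (⟦⟧-yes (j ≼? j) id) ⟨
      ⟦ j ≼? j ⟧ ℤ.* f j             ≡⟨ sum-single j (λ i i≢j →
          ⟦⟧-zero (i ≼? j) λ i≼j → go i (rec ((λ {x} → i≼j {x}) , i≢j))) ⟨
      sum (λ i → ⟦ i ≼? j ⟧ ℤ.* f i) ≡⟨ z j ⟩
      + 0                            ∎
      where open ≡-Reasoning

  -- The defining identity of μ sums over its second argument, which is exactly what shows that h
  -- has lower sums g. Uniqueness then identifies f with h.
  inversion : ∀ (f g : Fin m → ℤ) → (∀ j → sum (λ i → ⟦ i ≼? j ⟧ ℤ.* f i) ≡ g j) →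
              ∀ j → f j ≡ sum (λ i → ⟦ i ≼? j ⟧ ℤ.* (g i ℤ.* μ (Λ i) (Λ j)))
  inversion f g sums j = trans
    (ℤ.i-j≡0⇒i≡j (f j) (h j) (lower-sums-determine (λ i → f i ℤ.- h i) difference j))
    (sum-cong-≗ λ i → restrict i)
    where
    open ≡-Reasoning
    h : Fin m → ℤ
    h k = sum (λ i → g i ℤ.* μ (Λ i) (Λ k))
    restrict : ∀ i → g i ℤ.* μ (Λ i) (Λ j) ≡ ⟦ i ≼? j ⟧ ℤ.* (g i ℤ.* μ (Λ i) (Λ j))
    restrict i with i ≼? j
    ... | yes _   = sym (ℤ.*-identityˡ _)
    ... | no ¬i≼j = trans (cong (g i ℤ.*_) (mobius-zero (Λ i) (Λ j) (Λ-InΛ i) (Λ-InΛ j) ¬i≼j)) (ℤ.*-zeroʳ (g i))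
    h-sums : ∀ j → sum (λ k → ⟦ k ≼? j ⟧ ℤ.* h k) ≡ g j
    h-sums j = begin
      sum (λ k → ⟦ k ≼? j ⟧ ℤ.* h k)
        ≡⟨ sum-cong-≗ (λ k → *-distribˡ-sum ⟦ k ≼? j ⟧ (λ i → g i ℤ.* μ (Λ i) (Λ k))) ⟩
      sum (λ k → sum (λ i → ⟦ k ≼? j ⟧ ℤ.* (g i ℤ.* μ (Λ i) (Λ k))))
        ≡⟨ ∑-comm (λ k i → ⟦ k ≼? j ⟧ ℤ.* (g i ℤ.* μ (Λ i) (Λ k))) ⟩
      sum (λ i → sum (λ k → ⟦ k ≼? j ⟧ ℤ.* (g i ℤ.* μ (Λ i) (Λ k))))
        ≡⟨ sum-cong-≗ (λ i → trans
             (sum-cong-≗ (λ k → rearrange ⟦ k ≼? j ⟧ (g i) (μ (Λ i) (Λ k))))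
             (sym (*-distribˡ-sum (g i) (λ k → ⟦ k ≼? j ⟧ ℤ.* μ (Λ i) (Λ k))))) ⟩
      sum (λ i → g i ℤ.* sum (λ k → ⟦ k ≼? j ⟧ ℤ.* μ (Λ i) (Λ k)))
        ≡⟨ sum-cong-≗ (λ i → cong (g i ℤ.*_) (μ-column i j)) ⟩
      sum (λ i → g i ℤ.* ⟦ Λ i ≟S Λ j ⟧)
        ≡⟨ sum-single j (λ i i≢j → trans (cong (g i ℤ.*_) (⟦⟧-no (Λ i ≟S Λ j) (i≢j ∘ Λ-injective)))
                                          (ℤ.*-zeroʳ (g i))) ⟩
      g j ℤ.* ⟦ Λ j ≟S Λ j ⟧
        ≡⟨ trans (cong (g j ℤ.*_) (⟦⟧-yes (Λ j ≟S Λ j) refl)) (ℤ.*-identityʳ (g j)) ⟩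
      g j ∎
      where
      rearrange : ∀ a b c → a ℤ.* (b ℤ.* c) ≡ b ℤ.* (a ℤ.* c)
      rearrange = solve-∀
    difference : ∀ j → sum (λ i → ⟦ i ≼? j ⟧ ℤ.* (f i ℤ.- h i)) ≡ + 0
    difference j = begin
      ⟪ (λ i → ⟦ i ≼? j ⟧) , (λ i → f i ℤ.- h i) ⟫
        ≡⟨ ⟪⟫-cong {f = λ i → ⟦ i ≼? j ⟧} (λ _ → refl) (λ i → cong (λ k → f i ℤ.- k) (sym (ℤ.*-identityˡ (h i)))) ⟩
      ⟪ (λ i → ⟦ i ≼? j ⟧) , (λ i → f i ℤ.- + 1 ℤ.* h i) ⟫
        ≡⟨ ⟪⟫-∸ʳ (λ i → ⟦ i ≼? j ⟧) f (+ 1) h ⟩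
      ⟪ (λ i → ⟦ i ≼? j ⟧) , f ⟫ ℤ.- + 1 ℤ.* ⟪ (λ i → ⟦ i ≼? j ⟧) , h ⟫
        ≡⟨ cong₂ (λ a b → a ℤ.- + 1 ℤ.* b) (sums j) (h-sums j) ⟩
      g j ℤ.- + 1 ℤ.* g j
        ≡⟨ cancel (g j) ⟩
      + 0 ∎
      where
      cancel : ∀ a → a ℤ.- + 1 ℤ.* a ≡ + 0
      cancel = solve-∀

-- The Cartan invariants.

module Cartan {n : ℕ} (B : LRB n) (connected : LRBNotions.Connected B) {c ℓ : Level} (K : Field c ℓ)
              (e : Subset n → Fin n)
              (e-principal : ∀ X → LRBNotions.InΛ B X → LRBNotions.principal B (e X) ≡ X)
              (μ : Subset n → Subset n → ℤ) (mobius : LRBNotions.IsMobius B μ) (y : Fin n) where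
  open ≡ using (refl; sym; trans; cong; cong₂; subst; module ≡-Reasoning)
  open ℤΣ
  open LRB B
  open LRBNotions B
  open Modules K
  open Support B
  open IntegralFlags B y
  open ModuleTheory B y K using (compositionSeries)
  open Rank B y K using (sum-labels)
  open Inversion B μ mobius

  fixed-points : Fin m → ℤ
  fixed-points i = + card-eB∩L (e (Λ i)) Y

  -- Each label equals exactly one Λ i, so the left side counts the labels below Λ j, and this
  -- number is the rank of `e (Λ j)`.
  multiplicity-lower-sums : ∀ (S : CompositionSeries Y) j →
    sum (λ i → ⟦ i ≼? j ⟧ ℤ.* + multiplicity S (Λ i)) ≡ fixed-points j
  multiplicity-lower-sums S j = begin
    sum (λ i → ⟦ i ≼? j ⟧ ℤ.* + multiplicity S (Λ i))
      ≡⟨ sum-cong-≗ (λ i → trans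
           (cong (λ k → ⟦ i ≼? j ⟧ ℤ.* k) (count-sum (λ p → label p ≟S Λ i)))
           (*-distribˡ-sum ⟦ i ≼? j ⟧ (λ p → ⟦ label p ≟S Λ i ⟧))) ⟩
    sum (λ i → sum (λ p → ⟦ i ≼? j ⟧ ℤ.* ⟦ label p ≟S Λ i ⟧))
      ≡⟨ ∑-comm (λ i p → ⟦ i ≼? j ⟧ ℤ.* ⟦ label p ≟S Λ i ⟧) ⟩
    sum (λ p → sum (λ i → ⟦ i ≼? j ⟧ ℤ.* ⟦ label p ≟S Λ i ⟧))
      ≡⟨ sum-cong-≗ column ⟩
    sum (λ p → ⟦ label p ⊆? Λ j ⟧)
      ≡⟨ cong (λ X → sum (λ p → ⟦ label p ⊆? X ⟧)) (e-principal (Λ j) (Λ-InΛ j)) ⟨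
    sum (λ p → ⟦ label p ⊆? principal (e (Λ j)) ⟧)
      ≡⟨ sum-labels S (e (Λ j)) ⟩
    fixed-points j ∎
    where
    open ≡-Reasoning
    open CompositionSeries S
    column : ∀ p → sum (λ i → ⟦ i ≼? j ⟧ ℤ.* ⟦ label p ≟S Λ i ⟧) ≡ ⟦ label p ⊆? Λ j ⟧
    column p with Λ-index (labelΛ p)
    ... | k , eq = begin
      sum (λ i → ⟦ i ≼? j ⟧ ℤ.* ⟦ label p ≟S Λ i ⟧)
        ≡⟨ sum-single k (λ i i≢k → trans
             (cong (⟦ i ≼? j ⟧ ℤ.*_) (⟦⟧-no (label p ≟S Λ i) (λ q → i≢k (Λ-injective (sym (trans eq q))))))
             (ℤ.*-zeroʳ ⟦ i ≼? j ⟧)) ⟩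
      ⟦ k ≼? j ⟧ ℤ.* ⟦ label p ≟S Λ k ⟧
        ≡⟨ trans (cong (⟦ k ≼? j ⟧ ℤ.*_) (⟦⟧-yes (label p ≟S Λ k) (sym eq))) (ℤ.*-identityʳ ⟦ k ≼? j ⟧) ⟩
      ⟦ k ≼? j ⟧
        ≡⟨ cong (λ X → ⟦ X ⊆? Λ j ⟧) eq ⟩
      ⟦ label p ⊆? Λ j ⟧ ∎

  formula-sum : ∀ j → cartanFormula e μ (Λ j) Y ≡ sum (λ i → ⟦ i ≼? j ⟧ ℤ.* (fixed-points i ℤ.* μ (Λ i) (Λ j)))
  formula-sum j = sumℤ-filter (λ Z → Z ⊆? Λ j) (λ Z → + card-eB∩L (e Z) Y ℤ.* μ Z (Λ j)) ΛList

  multiplicity-formula : ∀ (S : CompositionSeries Y) j → + multiplicity S (Λ j) ≡ cartanFormula e μ (Λ j) Y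
  multiplicity-formula S j = trans
    (inversion (λ i → + multiplicity S (Λ i)) fixed-points (multiplicity-lower-sums S) j) (sym (formula-sum j))

  fixed-points-zero : ∀ i → ¬ Y ⊆ Λ i → fixed-points i ≡ + 0
  fixed-points-zero i ¬Y⊆ = trans (count-sum test) (sum-zero λ x → ⟦⟧-no (test x) λ { ((a , refl) , p) →
      ¬Y⊆ (subst (Y ⊆_) (e-principal (Λ i) (Λ-InΛ i)) (L-∙⁻ p)) })
    where
    test : ∀ x → Dec ((∃ λ a → e (Λ i) ∙ a ≡ x) × principal x ≡ Y)
    test x = any? (λ a → e (Λ i) ∙ a ≟ x) ×-dec (principal x ≟S Y)

  -- Write e for `e (Λ j)`. If ea has the support of e, then e ⊑ ea, that is, ea = e(ea) = e; so e
  -- is the only point counted.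
  fixed-points-one : ∀ j → Λ j ≡ Y → fixed-points j ≡ + 1
  fixed-points-one j ΛY = trans (count-sum test) (trans
      (sum-single (e (Λ j)) λ x x≢e → ⟦⟧-no (test x) λ { ((a , refl) , p) → x≢e (only a p) })
      (⟦⟧-yes (test (e (Λ j))) ((e (Λ j) , idem _) , eY)))
    where
    test : ∀ x → Dec ((∃ λ a → e (Λ j) ∙ a ≡ x) × principal x ≡ Y)
    test x = any? (λ a → e (Λ j) ∙ a ≟ x) ×-dec (principal x ≟S Y)
    eY : principal (e (Λ j)) ≡ Y
    eY = trans (e-principal (Λ j) (Λ-InΛ j)) ΛY
    only : ∀ a → principal (e (Λ j) ∙ a) ≡ Y → e (Λ j) ∙ a ≡ e (Λ j)
    only a p = trans (sym (trans (sym (assoc _ _ a)) (cong (_∙ a) (idem _)))) (≡-principal⁻ (trans eY (sym p)))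

  formula-zero : ∀ j → ¬ Y ⊆ Λ j → cartanFormula e μ (Λ j) Y ≡ + 0
  formula-zero j ¬Y⊆ = trans (formula-sum j) (sum-zero λ i → ⟦⟧-zero (i ≼? j) λ i≼j →
    cong (ℤ._* μ (Λ i) (Λ j)) (fixed-points-zero i (λ p → ¬Y⊆ (i≼j ∘ p))))

  formula-one : ∀ j → Λ j ≡ Y → cartanFormula e μ (Λ j) Y ≡ + 1
  formula-one j ΛY = trans (formula-sum j) (trans
    (sum-single j λ i i≢j → ⟦⟧-zero (i ≼? j) λ i≼j → cong (ℤ._* μ (Λ i) (Λ j))
      (fixed-points-zero i (λ p → i≢j (Λ-injective (⊆-antisym i≼j (p ∘ ⊆-reflexive ΛY))))))
    (cong₂ ℤ._*_ (⟦⟧-yes (j ≼? j) id) (cong₂ ℤ._*_ (fixed-points-one j ΛY) (μ-diagonal j))))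

  -- All series satisfy the same formula, which makes the multiplicity independent of the series.
  cartan : ∀ j → Σ ℕ λ k → CartanInvariantIs (Λ j) Y k × (+ k ≡ cartanFormula e μ (Λ j) Y)
                 × (¬ (Y ⊆ Λ j) → k ≡ 0) × (Λ j ≡ Y → k ≡ 1)
  cartan j = multiplicity S (Λ j)
    , (S , λ S′ → ℤ.+-injective (trans (multiplicity-formula S′ j) (sym (multiplicity-formula S j))))
    , multiplicity-formula S j
    , (λ ¬Y⊆ → ℤ.+-injective (trans (multiplicity-formula S j) (formula-zero j ¬Y⊆)))
    , (λ ΛY → ℤ.+-injective (trans (multiplicity-formula S j) (formula-one j ΛY)))
    where
    S : CompositionSeries Y
    S = compositionSeries connected

theorem4p17 : ∀ {c ℓ} (n : ℕ) (B : LRB n) → LRBNotions.Connected B →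
    (K : Field c ℓ) →
    (e : Subset n → Fin n) →
    (∀ X → LRBNotions.InΛ B X → LRBNotions.principal B (e X) ≡ X) →
    (μ : Subset n → Subset n → ℤ) → LRBNotions.IsMobius B μ →
    ∀ X Y → LRBNotions.InΛ B X → LRBNotions.InΛ B Y →
    Σ ℕ λ k → LRBNotions.Modules.CartanInvariantIs B K X Y k
    × (+ k ≡ LRBNotions.cartanFormula B e μ X Y)
    × (¬ (Y ⊆ X) → k ≡ 0)
    × (X ≡ Y → k ≡ 1)
theorem4p17 n B connected K e e-principal μ mobius X Y X∈Λ (y , ≡.refl)
  with Inversion.Λ-index B μ mobius X∈Λ
... | j , ≡.refl = Cartan.cartan B connected K e e-principal μ mobius y j
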